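{- Let $\alpha$ be a $k$-adic monotone connective such that $A_\alpha(p)<p$ on the interval $(0,1)$, $k>2$ and $\beta_{k-1}\le\frac{k-2}{k}$. There exists a constant $c_\alpha$ such that for all $n>0$, for the growth process $(\mu,\alpha)$ on $n$ variables with $\mu$ uniform on the $n$ projections and with limiting distribution $\pi$: if $i\ge 3\log(n)+c_\alpha$, then for all $n$-adic Boolean functions $f$, $|\pi_i(f)-\pi(f)|<2^{ -n}$.
   Context: A connective is a $k$-adic Boolean function $\alpha:\{0,1\}^k\to\{0,1\}$. Its characteristic polynomial is $A_\alpha(p)=\Pr[\alpha(X_1,\dots,X_k)=1]=\sum_{j=0}^k\beta_j\binom kj p^j(1-p)^{k-j}$, where the $X_j$ are independent binary variables each equal to 1 with probability $p$, and $\beta_j$ is the fraction of assignments of weight $j$ for which $\alpha$ is true. The growth process $(\mu,\alpha)$ gives distributions $\pi_i$ on $n$-adic Boolean functions: $\pi_0=\mu$, and for $i\ge1$, $\pi_i(f)$ is the probability that $\alpha(g_1,\dots,g_k)=f$ where $g_1,\dots,g_k$ are independent random functions distributed according to $\pi_{i-1}$. The limiting distribution is $\pi=\lim_{i\to\infty}\pi_i$ (pointwise). Logarithms are to base 2. -}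

module Defs where

open import Data.Bool.Base as Bool using (Bool; true; false; if_then_else_)
import Data.Bool.Properties as Bool
open import Data.Fin.Base using (Fin)
open import Data.Integer.Base as ℤ using (+_; +[1+_])
import Data.Integer.Properties as ℤ
import Data.Integer.Solver as ℤSolver
open import Data.List.Base as List using (List; []; _∷_; cartesianProductWith; allFin)
open import Data.Nat.Base as ℕ using (ℕ; zero; suc; _⊔_; s≤s; z≤n)
open import Data.Nat.Logarithm using (⌊log₂_⌋; ⌊log₂⌋-mono-≤; ⌊log₂[2^n]⌋≡n; ⌊log₂⌊n/2⌋⌋≡⌊log₂n⌋∸1)
import Data.Nat.Properties as ℕ
open import Data.Nat.Induction using (<-rec)
open import Data.Product.Base using (∃; _×_; _,_; proj₁; proj₂)
open import Data.Rational.Base as ℚ using (ℚ; mkℚ; 0ℚ; 1ℚ; ½; _/_)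
import Data.Rational.Properties as ℚ
open import Data.Rational.Solver using (module +-*-Solver)
import Data.Rational.Unnormalised.Base as ℚᵘ
import Data.Rational.Unnormalised.Properties as ℚᵘ
open import Data.Sum.Base using (inj₁; inj₂)
open import Data.Vec.Base as Vec using (Vec; []; _∷_; lookup; countᵇ)
open import Data.Vec.Relation.Binary.Pointwise.Inductive using (Pointwise)
open import Function.Base using (id; _∘_)
open import Relation.Binary.PropositionalEquality
open import Relation.Nullary.Decidable using (Dec; yes; no; does)
open import Relation.Nullary.Negation using (¬_)

------------------------------------------------------------------------
-- Real numbers

-- A real is a Cauchy sequence of rationals, and real numbers are only ever
-- compared through _<_ below.  The double negation makes the existential
-- classical: under excluded middle it can be dropped, giving the textbook
-- definition; without it, it keeps bounded monotone sequences Cauchy.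

Cauchy : (ℕ → ℚ) → Set
Cauchy s = ∀ ε → 0ℚ ℚ.< ε →
  ¬ ¬ (∃ λ N → ∀ m n → m ℕ.≥ N → n ℕ.≥ N → ℚ.∣ s m ℚ.- s n ∣ ℚ.≤ ε)

record ℝ : Set where
  constructor mkℝ
  field
    seq    : ℕ → ℚ
    cauchy : Cauchy seq

open ℝ public

private
  half-pos : ∀ {ε} → 0ℚ ℚ.< ε → 0ℚ ℚ.< ε ℚ.* ½
  half-pos {ε} 0<ε = subst (ℚ._< ε ℚ.* ½) (ℚ.*-zeroˡ ½) (ℚ.*-monoˡ-<-pos ½ 0<ε)

  half+half : ∀ ε → ε ℚ.* ½ ℚ.+ ε ℚ.* ½ ≡ ε
  half+half ε = trans (sym (ℚ.*-distribˡ-+ ε ½ ½)) (ℚ.*-identityʳ ε)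

  ∣∣≤ : ∀ {p q} → p ℚ.≤ q → ℚ.- p ℚ.≤ q → ℚ.∣ p ∣ ℚ.≤ q
  ∣∣≤ {p} h₁ h₂ with ℚ.∣p∣≡p∨∣p∣≡-p p
  ... | inj₁ eq = subst (ℚ._≤ _) (sym eq) h₁
  ... | inj₂ eq = subst (ℚ._≤ _) (sym eq) h₂

  p≤∣p∣ : ∀ p → p ℚ.≤ ℚ.∣ p ∣
  p≤∣p∣ p with ℚ.≤-total 0ℚ p
  ... | inj₁ 0≤p = ℚ.≤-reflexive (sym (ℚ.0≤p⇒∣p∣≡p 0≤p))
  ... | inj₂ p≤0 = ℚ.≤-trans p≤0 (ℚ.0≤∣p∣ p)

  swap-∣-∣ : ∀ p q → ℚ.∣ p ℚ.- q ∣ ≡ ℚ.∣ q ℚ.- p ∣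
  swap-∣-∣ p q = trans (sym (ℚ.∣-p∣≡∣p∣ (p ℚ.- q))) (cong ℚ.∣_∣
    (solve 2 (λ x y → :- (x :- y) := y :- x) refl p q))
    where open +-*-Solver

  ∣p∣≤ : ∀ p q → ℚ.∣ p ∣ ℚ.≤ ℚ.∣ q ∣ ℚ.+ ℚ.∣ p ℚ.- q ∣
  ∣p∣≤ p q = subst (λ r → ℚ.∣ r ∣ ℚ.≤ ℚ.∣ q ∣ ℚ.+ ℚ.∣ p ℚ.- q ∣)
    (solve 2 (λ x y → y :+ (x :- y) := x) refl p q)
    (ℚ.∣p+q∣≤∣p∣+∣q∣ q (p ℚ.- q))
    where open +-*-Solver

  ∣∣-∣∣≤ : ∀ p q → ℚ.∣ p ∣ ℚ.- ℚ.∣ q ∣ ℚ.≤ ℚ.∣ p ℚ.- q ∣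
  ∣∣-∣∣≤ p q = begin
    ℚ.∣ p ∣ ℚ.- ℚ.∣ q ∣                          ≤⟨ ℚ.+-monoˡ-≤ (ℚ.- ℚ.∣ q ∣) (∣p∣≤ p q) ⟩
    (ℚ.∣ q ∣ ℚ.+ ℚ.∣ p ℚ.- q ∣) ℚ.- ℚ.∣ q ∣      ≡⟨ solve 2 (λ x y → (x :+ y) :- x := y) refl ℚ.∣ q ∣ ℚ.∣ p ℚ.- q ∣ ⟩
    ℚ.∣ p ℚ.- q ∣                                ∎
    where open ℚ.≤-Reasoning
          open +-*-Solver

  *-mono-≤ : ∀ {p q r s} → 0ℚ ℚ.≤ p → 0ℚ ℚ.≤ s → p ℚ.≤ q → r ℚ.≤ s → p ℚ.* r ℚ.≤ q ℚ.* s
  *-mono-≤ {p} {q} {r} {s} 0≤p 0≤s p≤q r≤s = ℚ.≤-trans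
    (ℚ.*-monoˡ-≤-nonNeg p {{ℚ.nonNegative 0≤p}} r≤s)
    (ℚ.*-monoʳ-≤-nonNeg s {{ℚ.nonNegative 0≤s}} p≤q)

  self-close : ∀ p {ε} → 0ℚ ℚ.< ε → ℚ.∣ p ℚ.- p ∣ ℚ.≤ ε
  self-close p 0<ε = subst (λ r → ℚ.∣ r ∣ ℚ.≤ _) (sym (ℚ.+-inverseʳ p)) (ℚ.<⇒≤ 0<ε)

  +-cauchy : ∀ s t → Cauchy s → Cauchy t → Cauchy (λ m → s m ℚ.+ t m)
  +-cauchy s t cs ct ε 0<ε ¬c =
    cs (ε ℚ.* ½) (half-pos 0<ε) λ (N₁ , h₁) →
    ct (ε ℚ.* ½) (half-pos 0<ε) λ (N₂ , h₂) →
    ¬c (N₁ ⊔ N₂ , λ m n m≥ n≥ → begin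
      ℚ.∣ (s m ℚ.+ t m) ℚ.- (s n ℚ.+ t n) ∣
        ≡⟨ cong ℚ.∣_∣ (solve 4 (λ a b c d → (a :+ b) :- (c :+ d) := (a :- c) :+ (b :- d)) refl (s m) (t m) (s n) (t n)) ⟩
      ℚ.∣ (s m ℚ.- s n) ℚ.+ (t m ℚ.- t n) ∣
        ≤⟨ ℚ.∣p+q∣≤∣p∣+∣q∣ (s m ℚ.- s n) (t m ℚ.- t n) ⟩
      ℚ.∣ s m ℚ.- s n ∣ ℚ.+ ℚ.∣ t m ℚ.- t n ∣
        ≤⟨ ℚ.+-mono-≤ (h₁ m n (ℕ.m⊔n≤o⇒m≤o N₁ N₂ m≥) (ℕ.m⊔n≤o⇒m≤o N₁ N₂ n≥))
                      (h₂ m n (ℕ.m⊔n≤o⇒n≤o N₁ N₂ m≥) (ℕ.m⊔n≤o⇒n≤o N₁ N₂ n≥)) ⟩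
      ε ℚ.* ½ ℚ.+ ε ℚ.* ½ ≡⟨ half+half ε ⟩
      ε ∎)
    where open ℚ.≤-Reasoning
          open +-*-Solver

  -‿cauchy : ∀ s → Cauchy s → Cauchy (λ m → ℚ.- s m)
  -‿cauchy s cs ε 0<ε ¬c = cs ε 0<ε λ (N , h) → ¬c (N , λ m n m≥ n≥ →
    subst (ℚ._≤ ε) (sym (trans
      (cong ℚ.∣_∣ (solve 2 (λ x y → (:- x) :- (:- y) := :- (x :- y)) refl (s m) (s n)))
      (ℚ.∣-p∣≡∣p∣ (s m ℚ.- s n))))
    (h m n m≥ n≥))
    where open +-*-Solver

  ∣∣-cauchy : ∀ s → Cauchy s → Cauchy (λ m → ℚ.∣ s m ∣)
  ∣∣-cauchy s cs ε 0<ε ¬c = cs ε 0<ε λ (N , h) → ¬c (N , λ m n m≥ n≥ →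
    ℚ.≤-trans
      (∣∣≤ (∣∣-∣∣≤ (s m) (s n))
           (subst₂ ℚ._≤_
             (solve 2 (λ x y → y :- x := :- (x :- y)) refl ℚ.∣ s m ∣ ℚ.∣ s n ∣)
             (swap-∣-∣ (s n) (s m))
             (∣∣-∣∣≤ (s n) (s m))))
      (h m n m≥ n≥))
    where open +-*-Solver

  bounded : ∀ s → Cauchy s →
    ¬ ¬ (∃ λ B → 0ℚ ℚ.< B × ∃ λ N → ∀ m → m ℕ.≥ N → ℚ.∣ s m ∣ ℚ.≤ B)
  bounded s cs ¬b = cs 1ℚ 0<1 λ (N , h) → ¬b
    ( ℚ.∣ s N ∣ ℚ.+ 1ℚ
    , ℚ.+-mono-≤-< (ℚ.0≤∣p∣ (s N)) 0<1
    , N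
    , λ m m≥ → ℚ.≤-trans (∣p∣≤ (s m) (s N)) (ℚ.+-monoʳ-≤ ℚ.∣ s N ∣ (h m N m≥ ℕ.≤-refl)))
    where
    0<1 : 0ℚ ℚ.< 1ℚ
    0<1 = ℚ.positive⁻¹ 1ℚ

  *-cauchy : ∀ s t → Cauchy s → Cauchy t → Cauchy (λ m → s m ℚ.* t m)
  *-cauchy s t cs ct ε 0<ε ¬c =
    bounded s cs λ (B₁ , 0<B₁ , M₁ , b₁) →
    bounded t ct λ (B₂ , 0<B₂ , M₂ , b₂) →
    let B    = B₁ ℚ.+ B₂
        instance
          B-pos  = ℚ.positive (ℚ.+-mono-< 0<B₁ 0<B₂)
          B-nz   = ℚ.pos⇒nonZero B
          1/B-pos = ℚ.1/pos⇒pos B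
          ε-pos  = ℚ.positive 0<ε
        δ    = ε ℚ.* ℚ.1/ B
        0<δ  = ℚ.positive⁻¹ δ {{ℚ.pos*pos⇒pos ε (ℚ.1/ B)}}
        0≤δ  = ℚ.<⇒≤ 0<δ
    in
    cs δ 0<δ λ (N₁ , h₁) →
    ct δ 0<δ λ (N₂ , h₂) →
    ¬c ((M₁ ⊔ M₂) ⊔ (N₁ ⊔ N₂) , λ m n m≥ n≥ →
      let m≥M = ℕ.m⊔n≤o⇒m≤o (M₁ ⊔ M₂) (N₁ ⊔ N₂) m≥
          n≥M = ℕ.m⊔n≤o⇒m≤o (M₁ ⊔ M₂) (N₁ ⊔ N₂) n≥
          m≥N = ℕ.m⊔n≤o⇒n≤o (M₁ ⊔ M₂) (N₁ ⊔ N₂) m≥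
          n≥N = ℕ.m⊔n≤o⇒n≤o (M₁ ⊔ M₂) (N₁ ⊔ N₂) n≥
      in begin
      ℚ.∣ s m ℚ.* t m ℚ.- s n ℚ.* t n ∣
        ≡⟨ cong ℚ.∣_∣ (solve 4 (λ a b c d → a :* b :- c :* d := a :* (b :- d) :+ d :* (a :- c)) refl (s m) (t m) (s n) (t n)) ⟩
      ℚ.∣ s m ℚ.* (t m ℚ.- t n) ℚ.+ t n ℚ.* (s m ℚ.- s n) ∣
        ≤⟨ ℚ.∣p+q∣≤∣p∣+∣q∣ (s m ℚ.* (t m ℚ.- t n)) (t n ℚ.* (s m ℚ.- s n)) ⟩
      ℚ.∣ s m ℚ.* (t m ℚ.- t n) ∣ ℚ.+ ℚ.∣ t n ℚ.* (s m ℚ.- s n) ∣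
        ≡⟨ cong₂ ℚ._+_ (ℚ.∣p*q∣≡∣p∣*∣q∣ (s m) (t m ℚ.- t n)) (ℚ.∣p*q∣≡∣p∣*∣q∣ (t n) (s m ℚ.- s n)) ⟩
      ℚ.∣ s m ∣ ℚ.* ℚ.∣ t m ℚ.- t n ∣ ℚ.+ ℚ.∣ t n ∣ ℚ.* ℚ.∣ s m ℚ.- s n ∣
        ≤⟨ ℚ.+-mono-≤
             (*-mono-≤ (ℚ.0≤∣p∣ (s m)) 0≤δ (b₁ m (ℕ.m⊔n≤o⇒m≤o M₁ M₂ m≥M))
               (h₂ m n (ℕ.m⊔n≤o⇒n≤o N₁ N₂ m≥N) (ℕ.m⊔n≤o⇒n≤o N₁ N₂ n≥N)))
             (*-mono-≤ (ℚ.0≤∣p∣ (t n)) 0≤δ (b₂ n (ℕ.m⊔n≤o⇒n≤o M₁ M₂ n≥M))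
               (h₁ m n (ℕ.m⊔n≤o⇒m≤o N₁ N₂ m≥N) (ℕ.m⊔n≤o⇒m≤o N₁ N₂ n≥N))) ⟩
      B₁ ℚ.* δ ℚ.+ B₂ ℚ.* δ
        ≡⟨ solve 4 (λ a b e r → a :* (e :* r) :+ b :* (e :* r) := e :* ((a :+ b) :* r)) refl B₁ B₂ ε (ℚ.1/ B) ⟩
      ε ℚ.* (B ℚ.* ℚ.1/ B) ≡⟨ cong (ε ℚ.*_) (ℚ.*-inverseʳ B) ⟩
      ε ℚ.* 1ℚ             ≡⟨ ℚ.*-identityʳ ε ⟩
      ε ∎)
    where open ℚ.≤-Reasoning
          open +-*-Solver

fromℚ : ℚ → ℝ
fromℚ q = mkℝ (λ _ → q) λ ε 0<ε ¬c → ¬c (0 , λ _ _ _ _ → self-close q 0<ε)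

fromℕ : ℕ → ℝ
fromℕ n = fromℚ (+ n / 1)

0ℝ 1ℝ : ℝ
0ℝ = fromℚ 0ℚ
1ℝ = fromℚ 1ℚ

infixl 6 _+_ _-_
infixl 7 _*_
infix  8 -_
infix  4 _<_ _≤_

_+_ _*_ : ℝ → ℝ → ℝ
x + y = mkℝ (λ m → seq x m ℚ.+ seq y m) (+-cauchy (seq x) (seq y) (cauchy x) (cauchy y))
x * y = mkℝ (λ m → seq x m ℚ.* seq y m) (*-cauchy (seq x) (seq y) (cauchy x) (cauchy y))

-_ : ℝ → ℝ
- x = mkℝ (λ m → ℚ.- seq x m) (-‿cauchy (seq x) (cauchy x))

_-_ : ℝ → ℝ → ℝ
x - y = x + (- y)

∣_∣ : ℝ → ℝ
∣ x ∣ = mkℝ (λ m → ℚ.∣ seq x m ∣) (∣∣-cauchy (seq x) (cauchy x))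

_<_ _≤_ : ℝ → ℝ → Set
x < y = ∃ λ ε → 0ℚ ℚ.< ε × ∃ λ N → ∀ m → m ℕ.≥ N → seq x m ℚ.+ ε ℚ.≤ seq y m
x ≤ y = ¬ (y < x)

sumℝ : List ℝ → ℝ
sumℝ = List.foldr _+_ 0ℝ

productℝ : ∀ {k} → Vec ℝ k → ℝ
productℝ = Vec.foldr _ _*_ 1ℝ

_⟶_ : (ℕ → ℝ) → ℝ → Set
s ⟶ ℓ = ∀ ε → 0ℝ < ε → ∃ λ N → ∀ i → i ℕ.≥ N → ∣ s i - ℓ ∣ < ε

private
  2^⌊log₂⌋≤ : ∀ n .{{_ : ℕ.NonZero n}} → 2 ℕ.^ ⌊log₂ n ⌋ ℕ.≤ n
  2^⌊log₂⌋≤ n = <-rec P step n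
    where
    P : ℕ → Set
    P n = .{{_ : ℕ.NonZero n}} → 2 ℕ.^ ⌊log₂ n ⌋ ℕ.≤ n
    step : ∀ n → (∀ {m} → m ℕ.< n → P m) → P n
    step (suc zero) _ = s≤s z≤n
    step n@(suc (suc k)) rec = begin
      2 ℕ.^ ⌊log₂ n ⌋                        ≤⟨ ℕ.^-monoʳ-≤ 2 (ℕ.m≤n+m∸n ⌊log₂ n ⌋ 1) ⟩
      2 ℕ.* 2 ℕ.^ (⌊log₂ n ⌋ ℕ.∸ 1)          ≡⟨ cong (λ e → 2 ℕ.* 2 ℕ.^ e) (⌊log₂⌊n/2⌋⌋≡⌊log₂n⌋∸1 n) ⟨
      2 ℕ.* 2 ℕ.^ ⌊log₂ ℕ.⌊ n /2⌋ ⌋          ≤⟨ ℕ.*-monoʳ-≤ 2 (rec (ℕ.⌊n/2⌋<n (suc k))) ⟩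
      2 ℕ.* ℕ.⌊ n /2⌋                        ≡⟨ cong (ℕ.⌊ n /2⌋ ℕ.+_) (ℕ.+-identityʳ ℕ.⌊ n /2⌋) ⟩
      ℕ.⌊ n /2⌋ ℕ.+ ℕ.⌊ n /2⌋                ≤⟨ ℕ.+-monoʳ-≤ ℕ.⌊ n /2⌋ (ℕ.⌊n/2⌋≤⌈n/2⌉ n) ⟩
      ℕ.⌊ n /2⌋ ℕ.+ ℕ.⌈ n /2⌉                ≡⟨ ℕ.⌊n/2⌋+⌈n/2⌉≡n n ⟩
      n                                      ∎
      where open ℕ.≤-Reasoning

  ≤2^1+⌊log₂⌋ : ∀ n → n ℕ.≤ 2 ℕ.^ suc ⌊log₂ n ⌋
  ≤2^1+⌊log₂⌋ n with ℕ.≤-total n (2 ℕ.^ suc ⌊log₂ n ⌋)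
  ... | inj₁ h = h
  ... | inj₂ h with () ← ℕ.<-irrefl refl (subst (ℕ._≤ ⌊log₂ n ⌋) (⌊log₂[2^n]⌋≡n (suc ⌊log₂ n ⌋)) (⌊log₂⌋-mono-≤ h))

  cross : ∀ n .{{_ : ℕ.NonZero n}} j k →
    ⌊log₂ n ℕ.^ k ⌋ ℕ.* j ℕ.≤ suc ⌊log₂ n ℕ.^ j ⌋ ℕ.* k
  cross n j k = subst₂ ℕ._≤_ (⌊log₂[2^n]⌋≡n (F k ℕ.* j)) (⌊log₂[2^n]⌋≡n (suc (F j) ℕ.* k)) (⌊log₂⌋-mono-≤ (begin
    2 ℕ.^ (F k ℕ.* j)         ≡⟨ ℕ.^-*-assoc 2 (F k) j ⟨
    (2 ℕ.^ F k) ℕ.^ j         ≤⟨ ℕ.^-monoˡ-≤ j (2^⌊log₂⌋≤ (n ℕ.^ k) {{ℕ.m^n≢0 n k}}) ⟩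
    (n ℕ.^ k) ℕ.^ j           ≡⟨ ℕ.^-*-assoc n k j ⟩
    n ℕ.^ (k ℕ.* j)           ≡⟨ cong (n ℕ.^_) (ℕ.*-comm k j) ⟩
    n ℕ.^ (j ℕ.* k)           ≡⟨ ℕ.^-*-assoc n j k ⟨
    (n ℕ.^ j) ℕ.^ k           ≤⟨ ℕ.^-monoˡ-≤ k (≤2^1+⌊log₂⌋ (n ℕ.^ j)) ⟩
    (2 ℕ.^ suc (F j)) ℕ.^ k   ≡⟨ ℕ.^-*-assoc 2 (suc (F j)) k ⟩
    2 ℕ.^ (suc (F j) ℕ.* k)   ∎))
    where
    open ℕ.≤-Reasoning
    F : ℕ → ℕ
    F k = ⌊log₂ n ℕ.^ k ⌋

  /-mono-≤ : ∀ a b c d → a ℕ.* suc d ℕ.≤ c ℕ.* suc b → + a / suc b ℚ.≤ + c / suc d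
  /-mono-≤ a b c d h = ℚ.toℚᵘ-cancel-≤ (begin
    ℚ.toℚᵘ (+ a / suc b)      ≃⟨ ℚ.toℚᵘ-fromℚᵘ (+ a ℚᵘ./ suc b) ⟩
    + a ℚᵘ./ suc b            ≤⟨ ℚᵘ.*≤* (subst₂ ℤ._≤_ (ℤ.pos-* a (suc d)) (ℤ.pos-* c (suc b)) (ℤ.+≤+ h)) ⟩
    + c ℚᵘ./ suc d            ≃⟨ ℚ.toℚᵘ-fromℚᵘ (+ c ℚᵘ./ suc d) ⟨
    ℚ.toℚᵘ (+ c / suc d)      ∎)
    where open ℚᵘ.≤-Reasoning

  /-suc : ∀ a b → + suc a / suc b ≡ + a / suc b ℚ.+ + 1 / suc b
  /-suc a b = ℚ.toℚᵘ-injective (begin-equality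
    ℚ.toℚᵘ (+ suc a / suc b)                        ≃⟨ ℚ.toℚᵘ-fromℚᵘ (+ suc a ℚᵘ./ suc b) ⟩
    + suc a ℚᵘ./ suc b                              ≃⟨ ℚᵘ.*≡* (lemma (+ a) (+ suc b)) ⟩
    (+ a ℚᵘ./ suc b) ℚᵘ.+ (+ 1 ℚᵘ./ suc b)          ≃⟨ ℚᵘ.+-cong (ℚ.toℚᵘ-fromℚᵘ (+ a ℚᵘ./ suc b)) (ℚ.toℚᵘ-fromℚᵘ (+ 1 ℚᵘ./ suc b)) ⟨
    ℚ.toℚᵘ (+ a / suc b) ℚᵘ.+ ℚ.toℚᵘ (+ 1 / suc b)  ≃⟨ ℚ.toℚᵘ-homo-+ (+ a / suc b) (+ 1 / suc b) ⟨
    ℚ.toℚᵘ (+ a / suc b ℚ.+ + 1 / suc b)            ∎)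
    where
    open ℚᵘ.≤-Reasoning
    open ℤSolver.+-*-Solver
    lemma : ∀ x y → (ℤ.1ℤ ℤ.+ x) ℤ.* (y ℤ.* y) ≡ (x ℤ.* y ℤ.+ ℤ.1ℤ ℤ.* y) ℤ.* y
    lemma = solve 2 (λ x y → (con ℤ.1ℤ :+ x) :* (y :* y) := (x :* y :+ con ℤ.1ℤ :* y) :* y) refl

  archimedean : ∀ ε → 0ℚ ℚ.< ε → ∃ λ N → ∀ m → m ℕ.≥ N → + 1 / suc m ℚ.≤ ε
  archimedean ε@(mkℚ (+ zero) _ _) (ℚ.*<* (ℤ.+<+ ()))
  archimedean ε@(mkℚ (ℤ.-[1+ _ ]) _ _) (ℚ.*<* ())
  archimedean ε@(mkℚ +[1+ a ] d _) 0<ε = d , λ m m≥d →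
    subst (+ 1 / suc m ℚ.≤_) (ℚ.↥p/↧p≡p ε)
      (/-mono-≤ 1 m (suc a) d (ℕ.*-mono-≤ (s≤s (z≤n {a})) (s≤s m≥d)))

  log-seq : ℕ → ℕ → ℚ
  log-seq n m = + ⌊log₂ n ℕ.^ suc m ⌋ / suc m

  log-cauchy : ∀ n .{{_ : ℕ.NonZero n}} → Cauchy (log-seq n)
  log-cauchy n ε 0<ε ¬c = ¬c (N , λ i j i≥ j≥ →
    ∣∣≤ (bound i j j≥) (subst (ℚ._≤ ε) (flip i j) (bound j i i≥)))
    where
    N = proj₁ (archimedean ε 0<ε)
    flip : ∀ i j → log-seq n j ℚ.- log-seq n i ≡ ℚ.- (log-seq n i ℚ.- log-seq n j)
    flip i j = solve 2 (λ x y → y :- x := :- (x :- y)) refl (log-seq n i) (log-seq n j)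
      where open +-*-Solver
    bound : ∀ i j → j ℕ.≥ N → log-seq n i ℚ.- log-seq n j ℚ.≤ ε
    bound i j j≥ = begin
      log-seq n i ℚ.- log-seq n j
        ≤⟨ ℚ.+-monoˡ-≤ (ℚ.- log-seq n j) (/-mono-≤ ⌊log₂ n ℕ.^ suc i ⌋ i (suc ⌊log₂ n ℕ.^ suc j ⌋) j (cross n (suc j) (suc i))) ⟩
      (+ suc ⌊log₂ n ℕ.^ suc j ⌋ / suc j) ℚ.- log-seq n j
        ≡⟨ cong (ℚ._- log-seq n j) (/-suc ⌊log₂ n ℕ.^ suc j ⌋ j) ⟩
      (log-seq n j ℚ.+ + 1 / suc j) ℚ.- log-seq n j
        ≡⟨ solve 2 (λ x y → (x :+ y) :- x := y) refl (log-seq n j) (+ 1 / suc j) ⟩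
      + 1 / suc j
        ≤⟨ proj₂ (archimedean ε 0<ε) j j≥ ⟩
      ε ∎
      where open ℚ.≤-Reasoning
            open +-*-Solver

-- With K = m + 1, the m-th term ⌊log₂ (n ^ K)⌋ / K lies in
-- (log₂ n - 1/K , log₂ n].

log₂ : (n : ℕ) .{{_ : ℕ.NonZero n}} → ℝ
log₂ n = mkℝ (log-seq n) (log-cauchy n)

------------------------------------------------------------------------
-- Boolean functions and connectives

-- A k-adic connective is an element of BoolFun k.

BoolFun : ℕ → Set
BoolFun n = Vec Bool n → Bool

Monotone : ∀ {k} → BoolFun k → Set
Monotone α = ∀ {x y} → Pointwise Bool._≤_ x y → α x Bool.≤ α y

projection : ∀ {n} → Fin n → BoolFun n
projection j x = lookup x j

compose : ∀ {k n} → BoolFun k → Vec (BoolFun n) k → BoolFun n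
compose α gs x = α (Vec.map (λ g → g x) gs)

_≗?_ : ∀ {n} (f g : BoolFun n) → Dec (f ≗ g)
_≗?_ {zero} f g with f [] Bool.≟ g []
... | yes eq = yes λ { [] → eq }
... | no neq = no λ f≗g → neq (f≗g [])
_≗?_ {suc n} f g with (f ∘ (true ∷_)) ≗? (g ∘ (true ∷_)) | (f ∘ (false ∷_)) ≗? (g ∘ (false ∷_))
... | yes t  | yes u  = yes λ { (true ∷ x) → t x ; (false ∷ x) → u x }
... | no ¬t  | _      = no λ f≗g → ¬t λ x → f≗g (true ∷ x)
... | yes _  | no ¬u  = no λ f≗g → ¬u λ x → f≗g (false ∷ x)

tuples : ∀ {A : Set} → List A → ∀ k → List (Vec A k)
tuples xs zero    = [] ∷ []
tuples xs (suc k) = cartesianProductWith _∷_ xs (tuples xs k)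

assignments : ∀ k → List (Vec Bool k)
assignments = tuples (true ∷ false ∷ [])

branch : ∀ {n} → BoolFun n → BoolFun n → BoolFun (suc n)
branch f g (b ∷ x) = if b then f x else g x

-- Every n-adic Boolean function occurs in this list exactly once up to
-- pointwise equality.

functions : ∀ n → List (BoolFun n)
functions zero    = (λ _ → true) ∷ (λ _ → false) ∷ []
functions (suc n) = cartesianProductWith branch (functions n) (functions n)

------------------------------------------------------------------------
-- The characteristic polynomial and the fractions βⱼ

-- The probability of the assignment x when its entries are independent and each
-- equals true with probability p.

probability : ∀ {k} → ℝ → Vec Bool k → ℝ
probability p x = productℝ (Vec.map (λ b → if b then p else 1ℝ - p) x)

A : ∀ {k} → BoolFun k → ℝ → ℝ
A {k} α p = sumℝ (List.map (probability p) (List.filterᵇ α (assignments k)))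

-- The fraction a / b; the value at b = 0 is junk.

ratio : ℕ → ℕ → ℚ
ratio a zero      = 0ℚ
ratio a b@(suc _) = + a / b

weight : ∀ {k} → Vec Bool k → ℕ
weight = countᵇ id

β : ∀ {k} → BoolFun k → ℕ → ℚ
β {k} α j = ratio (List.length (List.filterᵇ α slice)) (List.length slice)
  where
  slice : List (Vec Bool k)
  slice = List.filterᵇ (λ x → weight x ℕ.≡ᵇ j) (assignments k)

------------------------------------------------------------------------
-- Growth processes

sumℚ : List ℚ → ℚ
sumℚ = List.foldr ℚ._+_ 0ℚ

productℚ : ∀ {k} → Vec ℚ k → ℚ
productℚ = Vec.foldr _ ℚ._*_ 1ℚ

uniformProjections : ∀ n .{{_ : ℕ.NonZero n}} → BoolFun n → ℚ
uniformProjections n f =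
  sumℚ (List.map (λ j → if does (projection j ≗? f) then + 1 / n else 0ℚ) (allFin n))

growth : ∀ {n k} → (BoolFun n → ℚ) → BoolFun k → ℕ → BoolFun n → ℚ
growth         μ α zero    f = μ f
growth {n} {k} μ α (suc i) f =
  sumℚ (List.map
    (λ gs → if does (compose α gs ≗? f)
            then productℚ (Vec.map (growth μ α i) gs)
            else 0ℚ)
    (tuples (functions n) k))

IsLimitingDistribution : ∀ {n k} → (BoolFun n → ℚ) → BoolFun k → (BoolFun n → ℝ) → Set
IsLimitingDistribution μ α π = ∀ f → (λ i → fromℚ (growth μ α i f)) ⟶ π f

module Submission where

-- Write F for the characteristic polynomial of α as a map of the rationals of
-- [0 , 1] into themselves (prob).  If a random function is true at x with
-- probability p, then the function grown from independent copies of it is true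
-- at x with probability F p (truth-suc).  Initially this probability is 1 at the
-- all-true assignment and at most 1 - 1/n at every other one.  From the first
-- step on it is α (true , ... , true) at the all-true assignment, and elsewhere
-- it is bounded by the orbit of 1 - 1/n under F, because F is monotone; that
-- orbit tends to 0.  So the limit is the point mass at limit-function: the
-- conjunction of all variables, or the constant false if α is never true.  A
-- union bound over the 2^n assignments (growth-union-bound) bounds the distance
-- to the limit by 2^n times the i-th point of the orbit, and it remains to show
-- that the latter is at most 2^(-2n-1) for i = 3 log n + O(1).
--
-- The orbit passes through three phases (orbit-decay).
--
--  * Near 1.  The bound on the fraction of true assignments of weight k - 1 says
--    that at least two of them are false (two-false), whence
--    1 - F (1 - q) ≥ 3/2 q for all q ≤ 1/(4k) (near1).  Two steps at least
--    double the distance to 1, so 2 log n + O(1) steps bring it from 1/n to 1/(4k).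
--
--  * In the middle.  A number of steps that depends on α alone leads from
--    1 - 1/(4k) below any given lo > 0 (descend).  The gap between F p and p that
--    this needs comes from the hypothesis on A at a single real number: the limit
--    of the sequence s given by s 0 = 1 - 1/(4k) and s (m + 1) = max (F (s m)) lo.
--    The terms of s are rational and decrease, so it represents a real whether or
--    not anything is known about its limit, and that real is positive by
--    construction.
--
--  * Near 0.  If α were true at an assignment with at most one true entry, then by
--    monotonicity F p ≥ p for all p (light-true⇒id≤prob), which contradicts the
--    hypothesis on A.  Hence F p ≤ k² p²
--    (prob≤quadratic), and repeated squaring makes log n + O(1) further steps
--    enough (squaring).

open import Data.Bool.Base as Bool using (Bool; true; false; if_then_else_; not; _∧_; _xor_; b≤b; f≤t)
import Data.Bool.Properties as Bool
open import Data.Fin.Base using (Fin; zero; suc)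
import Data.Integer.Base as ℤ
import Data.Integer.Properties as ℤ
open import Data.List.Base as List using (List; []; _∷_; _++_; cartesianProductWith; filterᵇ; length; allFin)
import Data.List.Properties as List
open import Data.List.Membership.Propositional using (_∈_)
open import Data.List.Membership.Propositional.Properties using (∈-allFin)
open import Data.List.Relation.Unary.Any using (here; there)
open import Data.Nat.Base as ℕ using (ℕ; zero; suc; NonZero; z≤n; s≤s; _^_)
open import Data.Nat.GeneralisedArithmetic using (fold; fold-+)
open import Data.Nat.Logarithm using (⌊log₂_⌋; ⌊log₂⌋-mono-≤; ⌊log₂[2^n]⌋≡n)
import Data.Nat.Properties as ℕ
import Data.Nat.Tactic.RingSolver as ℕ-Solver
open import Data.Product.Base using (∃; _×_; _,_; proj₁; proj₂)
open import Data.Rational.Base as ℚ using (ℚ; mkℚ; 0ℚ; 1ℚ; ½; _/_)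
import Data.Rational.Properties as ℚ
open import Data.Rational.Solver using (module +-*-Solver)
import Data.Rational.Unnormalised.Base as ℚᵘ
import Data.Rational.Unnormalised.Properties as ℚᵘ
open import Data.Sum.Base using (_⊎_; inj₁; inj₂)
open import Data.Vec.Base as Vec using (Vec; []; _∷_; lookup)
open import Data.Vec.Relation.Binary.Pointwise.Inductive as Pointwise using (_∷_)
open import Function.Base using (_∘_; id; const)
open import Function.Bundles using (mk⇔)
open import Relation.Binary.PropositionalEquality
open import Relation.Nullary.Decidable using (yes; no; does; does-⇔)
open import Relation.Nullary.Negation using (¬_; contradiction)
import Algebra.Bundles
import Algebra.Properties.Semiring.Exp
import Defs
open +-*-Solver using (solve; _:=_; con; _:+_; _:*_; _:-_; :-_)

-- Rational inequalities, natural numbers as rationals, and powers of one half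
module Rationals where

  open import Data.Rational.Base using (_+_; _*_; _-_; -_; _≤_; _<_; ∣_∣)
  open Algebra.Properties.Semiring.Exp (Algebra.Bundles.CommutativeRing.semiring ℚ.+-*-commutativeRing) public
    using (^-homo-*) renaming (_^_ to _^ℚ_)

  -- To prove a ≤ b it suffices to exhibit b as a plus something nonnegative.
  ≤-by : ∀ {a b} d → 0ℚ ≤ d → b ≡ a + d → a ≤ b
  ≤-by {a} d 0≤d refl = subst (_≤ a + d) (ℚ.+-identityʳ a) (ℚ.+-monoʳ-≤ a 0≤d)

  0≤+ : ∀ {a b} → 0ℚ ≤ a → 0ℚ ≤ b → 0ℚ ≤ a + b
  0≤+ = ℚ.+-mono-≤

  0≤* : ∀ {a b} → 0ℚ ≤ a → 0ℚ ≤ b → 0ℚ ≤ a * b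
  0≤* {a} {b} 0≤a 0≤b =
    subst (_≤ a * b) (ℚ.*-zeroʳ a) (ℚ.*-monoˡ-≤-nonNeg a {{ℚ.nonNegative 0≤a}} 0≤b)

  0≤- : ∀ {a b} → a ≤ b → 0ℚ ≤ b - a
  0≤- {a} {b} a≤b = subst (_≤ b - a) (ℚ.+-inverseʳ a) (ℚ.+-monoˡ-≤ (- a) a≤b)

  *-mono-≤ : ∀ {a b c d} → 0ℚ ≤ a → 0ℚ ≤ d → a ≤ b → c ≤ d → a * c ≤ b * d
  *-mono-≤ {a} {b} {c} {d} 0≤a 0≤d a≤b c≤d = ≤-by ((b - a) * d + a * (d - c))
    (0≤+ (0≤* (0≤- a≤b) 0≤d) (0≤* 0≤a (0≤- c≤d)))
    (solve 4 (λ a b c d → b :* d := a :* c :+ ((b :- a) :* d :+ a :* (d :- c))) refl a b c d)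

  *-monoʳ-≤ : ∀ {a b} c → 0ℚ ≤ c → a ≤ b → c * a ≤ c * b
  *-monoʳ-≤ c 0≤c = ℚ.*-monoˡ-≤-nonNeg c {{ℚ.nonNegative 0≤c}}

  *-cancelˡ-≤ : ∀ {a b c} → 0ℚ < c → c * a ≤ c * b → a ≤ b
  *-cancelˡ-≤ {c = c} 0<c = ℚ.*-cancelˡ-≤-pos c {{ℚ.positive 0<c}}

  0<* : ∀ {a b} → 0ℚ < a → 0ℚ < b → 0ℚ < a * b
  0<* {a} {b} 0<a 0<b = ℚ.positive⁻¹ (a * b) {{ℚ.pos*pos⇒pos a {{ℚ.positive 0<a}} b {{ℚ.positive 0<b}}}}

  0<- : ∀ {a b} → a < b → 0ℚ < b - a
  0<- {a} {b} a<b = subst (_< b - a) (ℚ.+-inverseʳ a) (ℚ.+-monoˡ-< (- a) a<b)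

  0≤1 : 0ℚ ≤ 1ℚ
  0≤1 = ℚ.nonNegative⁻¹ 1ℚ

  0<1 : 0ℚ < 1ℚ
  0<1 = ℚ.positive⁻¹ 1ℚ

  <⇒≱ : ∀ {a b} → a < b → ¬ (b ≤ a)
  <⇒≱ a<b b≤a = ℚ.<-irrefl refl (ℚ.<-≤-trans a<b b≤a)

  1≰0 : ¬ (1ℚ ≤ 0ℚ)
  1≰0 = <⇒≱ 0<1

  ∣∣≤ : ∀ {a b} → a ≤ b → - a ≤ b → ∣ a ∣ ≤ b
  ∣∣≤ {a} h₁ h₂ with ℚ.∣p∣≡p∨∣p∣≡-p a
  ... | inj₁ eq = subst (_≤ _) (sym eq) h₁
  ... | inj₂ eq = subst (_≤ _) (sym eq) h₂

  -- Membership in the unit interval.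
  InUnit : ℚ → Set
  InUnit p = 0ℚ ≤ p × p ≤ 1ℚ

  ∁-InUnit : ∀ {p} → InUnit p → InUnit (1ℚ - p)
  ∁-InUnit {p} (0≤p , p≤1) = 0≤- p≤1 ,
    ≤-by p 0≤p (solve 1 (λ p → con 1ℚ := (con 1ℚ :- p) :+ p) refl p)

  -- The image of a natural number.  It is opaque so that conversion checking never
  -- normalises the fraction.
  opaque
    ι : ℕ → ℚ
    ι n = ℤ.+ n / 1

    ι-def : ∀ n → ι n ≡ ℤ.+ n / 1
    ι-def n = refl

    ι0≡0 : ι 0 ≡ 0ℚ
    ι0≡0 = refl

    ι1≡1 : ι 1 ≡ 1ℚ
    ι1≡1 = refl

  private
    ι≃ : ∀ n → ℚ.toℚᵘ (ι n) ℚᵘ.≃ (ℤ.+ n ℚᵘ./ 1)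
    ι≃ n = subst (λ x → ℚ.toℚᵘ x ℚᵘ.≃ (ℤ.+ n ℚᵘ./ 1)) (sym (ι-def n)) (ℚ.toℚᵘ-fromℚᵘ (ℤ.+ n ℚᵘ./ 1))

  ι-+ : ∀ m n → ι (m ℕ.+ n) ≡ ι m + ι n
  ι-+ m n = ℚ.toℚᵘ-injective (begin-equality
    ℚ.toℚᵘ (ι (m ℕ.+ n))               ≃⟨ ι≃ (m ℕ.+ n) ⟩
    ℤ.+ (m ℕ.+ n) ℚᵘ./ 1               ≃⟨ ℚᵘ.*≡* (cong (ℤ._* ℤ.+ 1)
                                            (sym (cong₂ ℤ._+_ (ℤ.*-identityʳ (ℤ.+ m)) (ℤ.*-identityʳ (ℤ.+ n))))) ⟩
    (ℤ.+ m ℚᵘ./ 1) ℚᵘ.+ (ℤ.+ n ℚᵘ./ 1) ≃⟨ ℚᵘ.+-cong (ι≃ m) (ι≃ n) ⟨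
    ℚ.toℚᵘ (ι m) ℚᵘ.+ ℚ.toℚᵘ (ι n)     ≃⟨ ℚ.toℚᵘ-homo-+ (ι m) (ι n) ⟨
    ℚ.toℚᵘ (ι m + ι n)                 ∎)
    where open ℚᵘ.≤-Reasoning

  ι-* : ∀ m n → ι (m ℕ.* n) ≡ ι m * ι n
  ι-* m n = ℚ.toℚᵘ-injective (begin-equality
    ℚ.toℚᵘ (ι (m ℕ.* n))               ≃⟨ ι≃ (m ℕ.* n) ⟩
    ℤ.+ (m ℕ.* n) ℚᵘ./ 1               ≃⟨ ℚᵘ.*≡* (cong (ℤ._* ℤ.+ 1) (ℤ.pos-* m n)) ⟩
    (ℤ.+ m ℚᵘ./ 1) ℚᵘ.* (ℤ.+ n ℚᵘ./ 1) ≃⟨ ℚᵘ.*-cong (ι≃ m) (ι≃ n) ⟨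
    ℚ.toℚᵘ (ι m) ℚᵘ.* ℚ.toℚᵘ (ι n)     ≃⟨ ℚ.toℚᵘ-homo-* (ι m) (ι n) ⟨
    ℚ.toℚᵘ (ι m * ι n)                 ∎)
    where open ℚᵘ.≤-Reasoning

  -- The quotient m / n is characterised by its product with n.
  /-*-ι : ∀ m n .{{_ : NonZero n}} → (ℤ.+ m / n) * ι n ≡ ι m
  /-*-ι m n@(suc _) = ℚ.toℚᵘ-injective (begin-equality
    ℚ.toℚᵘ ((ℤ.+ m / n) * ι n)                   ≃⟨ ℚ.toℚᵘ-homo-* (ℤ.+ m / n) (ι n) ⟩
    ℚ.toℚᵘ (ℤ.+ m / n) ℚᵘ.* ℚ.toℚᵘ (ι n)         ≃⟨ ℚᵘ.*-cong (ℚ.toℚᵘ-fromℚᵘ (ℤ.+ m ℚᵘ./ n)) (ι≃ n) ⟩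
    (ℤ.+ m ℚᵘ./ n) ℚᵘ.* (ℤ.+ n ℚᵘ./ 1)           ≃⟨ ℚᵘ.*≡* (trans (ℤ.*-identityʳ _)
                                                      (cong (ℤ.+ m ℤ.*_) (cong ℤ.+_ (sym (ℕ.*-identityʳ n))))) ⟩
    ℤ.+ m ℚᵘ./ 1                                 ≃⟨ ι≃ m ⟨
    ℚ.toℚᵘ (ι m)                                 ∎)
    where open ℚᵘ.≤-Reasoning

  ι-suc : ∀ n → ι (suc n) ≡ 1ℚ + ι n
  ι-suc n = trans (ι-+ 1 n) (cong (_+ ι n) ι1≡1)

  0≤ι : ∀ n → 0ℚ ≤ ι n
  0≤ι n = subst (0ℚ ≤_) (sym (ι-def n)) (ℚ.nonNegative⁻¹ (ℤ.+ n / 1) {{ℚ.normalize-nonNeg n 1}})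

  ι-mono : ∀ {m n} → m ℕ.≤ n → ι m ≤ ι n
  ι-mono {m} {n} m≤n = ≤-by (ι (n ℕ.∸ m)) (0≤ι (n ℕ.∸ m))
    (trans (cong ι (sym (ℕ.m+[n∸m]≡n m≤n))) (ι-+ m (n ℕ.∸ m)))

  1≤ι : ∀ n .{{_ : NonZero n}} → 1ℚ ≤ ι n
  1≤ι (suc n) = subst (_≤ ι (suc n)) ι1≡1 (ι-mono {1} {suc n} (s≤s z≤n))

  0<ι : ∀ n .{{_ : NonZero n}} → 0ℚ < ι n
  0<ι n = ℚ.<-≤-trans 0<1 (1≤ι n)

  0<1/ : ∀ n .{{_ : NonZero n}} → 0ℚ < ℤ.+ 1 / n
  0<1/ n = ℚ.positive⁻¹ (ℤ.+ 1 / n) {{ℚ.normalize-pos 1 n}}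

  1/*ι : ∀ n .{{_ : NonZero n}} → (ℤ.+ 1 / n) * ι n ≡ 1ℚ
  1/*ι n = trans (/-*-ι 1 n) ι1≡1

  1/≤1 : ∀ n .{{_ : NonZero n}} → ℤ.+ 1 / n ≤ 1ℚ
  1/≤1 n = subst (_≤ 1ℚ) (ℚ.*-identityʳ (ℤ.+ 1 / n))
    (ℚ.≤-trans (*-monoʳ-≤ (ℤ.+ 1 / n) (ℚ.<⇒≤ (0<1/ n)) (1≤ι n)) (ℚ.≤-reflexive (1/*ι n)))

  archimedean : ∀ {ε} → 0ℚ < ε → ∃ λ j → 1ℚ ≤ ι j * ε
  archimedean {ε@(mkℚ ℤ.+[1+ a ] d _)} 0<ε = suc d , (begin
    1ℚ                                ≤⟨ 1≤ι (suc a) ⟩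
    ι (suc a)                         ≡⟨ /-*-ι (suc a) (suc d) ⟨
    (ℤ.+ suc a / suc d) * ι (suc d)   ≡⟨ cong (_* ι (suc d)) (ℚ.↥p/↧p≡p ε) ⟩
    ε * ι (suc d)                     ≡⟨ ℚ.*-comm ε (ι (suc d)) ⟩
    ι (suc d) * ε                     ∎)
    where open ℚ.≤-Reasoning
  archimedean {mkℚ ℤ.+0 _ _} (ℚ.*<* (ℤ.+<+ ()))
  archimedean {mkℚ ℤ.-[1+ _ ] _ _} (ℚ.*<* ())

  antitone : ∀ (s : ℕ → ℚ) → (∀ m → s (suc m) ≤ s m) → ∀ {m n} → m ℕ.≤ n → s n ≤ s m
  antitone s step {m} m≤n = go (ℕ.≤⇒≤′ m≤n)
    where
    go : ∀ {n} → m ℕ.≤′ n → s n ≤ s m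
    go ℕ.≤′-refl = ℚ.≤-refl
    go (ℕ.≤′-step {n} h) = ℚ.≤-trans (step n) (go h)

  0≤½^ : ∀ m → 0ℚ ≤ ½ ^ℚ m
  0≤½^ zero = 0≤1
  0≤½^ (suc m) = 0≤* (ℚ.nonNegative⁻¹ ½) (0≤½^ m)

  0<½^ : ∀ m → 0ℚ < ½ ^ℚ m
  0<½^ zero = 0<1
  0<½^ (suc m) = 0<* (ℚ.positive⁻¹ ½) (0<½^ m)

  ½^-suc-+ : ∀ m → ½ ^ℚ suc m + ½ ^ℚ suc m ≡ ½ ^ℚ m
  ½^-suc-+ m = solve 1 (λ x → con ½ :* x :+ con ½ :* x := x) refl (½ ^ℚ m)

  ½^-antitone : ∀ {m n} → m ℕ.≤ n → ½ ^ℚ n ≤ ½ ^ℚ m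
  ½^-antitone = antitone (½ ^ℚ_) λ m → ≤-by (½ ^ℚ suc m) (0≤½^ (suc m)) (sym (½^-suc-+ m))

  ½^*ι2^ : ∀ m → ½ ^ℚ m * ι (2 ℕ.^ m) ≡ 1ℚ
  ½^*ι2^ zero = cong (1ℚ *_) ι1≡1
  ½^*ι2^ (suc m) = begin
    (½ * h) * ι (2 ℕ.* 2 ℕ.^ m)     ≡⟨ cong ((½ * h) *_) (ι-* 2 (2 ℕ.^ m)) ⟩
    (½ * h) * (ι 2 * i)             ≡⟨ cong (λ x → (½ * h) * (x * i)) (ι-def 2) ⟩
    (½ * h) * ((ℤ.+ 2 / 1) * i)     ≡⟨ solve 2 (λ x y → (con ½ :* x) :* (con (ℤ.+ 2 / 1) :* y) := x :* y) refl h i ⟩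
    h * i                           ≡⟨ ½^*ι2^ m ⟩
    1ℚ                              ∎
    where
    open ≡-Reasoning
    h = ½ ^ℚ m
    i = ι (2 ℕ.^ m)

  n<2^n : ∀ n → n ℕ.< 2 ℕ.^ n
  n<2^n zero = s≤s z≤n
  n<2^n (suc n) = begin
    2 ℕ.+ n                    ≤⟨ s≤s (n<2^n n) ⟩
    1 ℕ.+ 2 ℕ.^ n              ≤⟨ ℕ.+-monoˡ-≤ (2 ℕ.^ n) (ℕ.m^n>0 2 n) ⟩
    2 ℕ.^ n ℕ.+ 2 ℕ.^ n        ≡⟨ cong (2 ℕ.^ n ℕ.+_) (ℕ.+-identityʳ _) ⟨
    2 ℕ.^ suc n                ∎
    where open ℕ.≤-Reasoning

  ½^-small : ∀ {ε} → 0ℚ < ε → ∃ λ m → ½ ^ℚ m ≤ ε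
  ½^-small {ε} 0<ε with archimedean 0<ε
  ... | j , 1≤jε = j , (begin
    h                       ≡⟨ ℚ.*-identityʳ h ⟨
    h * 1ℚ                  ≤⟨ *-monoʳ-≤ h (0≤½^ j) 1≤jε ⟩
    h * (ι j * ε)           ≤⟨ *-monoʳ-≤ h (0≤½^ j) (*-mono-≤ (0≤ι j) (ℚ.<⇒≤ 0<ε) (ι-mono (ℕ.<⇒≤ (n<2^n j))) ℚ.≤-refl) ⟩
    h * (ι (2 ℕ.^ j) * ε)   ≡⟨ ℚ.*-assoc h _ ε ⟨
    h * ι (2 ℕ.^ j) * ε     ≡⟨ cong (_* ε) (½^*ι2^ j) ⟩
    1ℚ * ε                  ≡⟨ ℚ.*-identityˡ ε ⟩
    ε                       ∎)
    where open ℚ.≤-Reasoning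
          h = ½ ^ℚ j

-- Indicators and finite sums of rational numbers
module Sums where

  open import Data.Rational.Base using (_+_; _*_; _-_; _≤_)
  open Defs using (sumℚ)
  open Rationals

  private variable
    X Y Z : Set

  -- The value of a Boolean as a rational number: the indicator of an event.
  ⟦_⟧ : Bool → ℚ
  ⟦ b ⟧ = if b then 1ℚ else 0ℚ

  ⟦⟧-unit : ∀ b → InUnit ⟦ b ⟧
  ⟦⟧-unit true  = 0≤1 , ℚ.≤-refl
  ⟦⟧-unit false = ℚ.≤-refl , 0≤1

  if-⟦⟧ : ∀ b q → (if b then q else 0ℚ) ≡ ⟦ b ⟧ * q
  if-⟦⟧ true  q = sym (ℚ.*-identityˡ q)
  if-⟦⟧ false q = sym (ℚ.*-zeroˡ q)

  ⟦not⟧ : ∀ b → ⟦ not b ⟧ ≡ 1ℚ - ⟦ b ⟧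
  ⟦not⟧ true  = refl
  ⟦not⟧ false = refl

  ⟦∧⟧ : ∀ a b → ⟦ a ∧ b ⟧ ≡ ⟦ a ⟧ * ⟦ b ⟧
  ⟦∧⟧ true  b = sym (ℚ.*-identityˡ ⟦ b ⟧)
  ⟦∧⟧ false b = sym (ℚ.*-zeroˡ ⟦ b ⟧)

  -- The sum of the values of a function over the members of a list, with repetitions.
  Σ[_] : List X → (X → ℚ) → ℚ
  Σ[ xs ] f = sumℚ (List.map f xs)

  Σ-cong : ∀ {f g : X → ℚ} → f ≗ g → ∀ xs → Σ[ xs ] f ≡ Σ[ xs ] g
  Σ-cong f≗g []       = refl
  Σ-cong f≗g (x ∷ xs) = cong₂ _+_ (f≗g x) (Σ-cong f≗g xs)

  Σ-mono : ∀ {f g : X → ℚ} → (∀ x → f x ≤ g x) → ∀ xs → Σ[ xs ] f ≤ Σ[ xs ] g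
  Σ-mono f≤g []       = ℚ.≤-refl
  Σ-mono f≤g (x ∷ xs) = ℚ.+-mono-≤ (f≤g x) (Σ-mono f≤g xs)

  Σ-nonneg : ∀ {f : X → ℚ} → (∀ x → 0ℚ ≤ f x) → ∀ xs → 0ℚ ≤ Σ[ xs ] f
  Σ-nonneg 0≤f []       = ℚ.≤-refl
  Σ-nonneg 0≤f (x ∷ xs) = 0≤+ (0≤f x) (Σ-nonneg 0≤f xs)

  Σ-++ : ∀ xs ys (f : X → ℚ) → Σ[ xs ++ ys ] f ≡ Σ[ xs ] f + Σ[ ys ] f
  Σ-++ []       ys f = sym (ℚ.+-identityˡ _)
  Σ-++ (x ∷ xs) ys f = trans (cong (f x +_) (Σ-++ xs ys f)) (sym (ℚ.+-assoc (f x) _ _))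

  Σ-map : ∀ (g : X → Y) xs (f : Y → ℚ) → Σ[ List.map g xs ] f ≡ Σ[ xs ] (f ∘ g)
  Σ-map g []       f = refl
  Σ-map g (x ∷ xs) f = cong (f (g x) +_) (Σ-map g xs f)

  Σ-product : ∀ (g : X → Y → Z) xs ys (f : Z → ℚ) →
    Σ[ cartesianProductWith g xs ys ] f ≡ Σ[ xs ] λ x → Σ[ ys ] λ y → f (g x y)
  Σ-product g []       ys f = refl
  Σ-product g (x ∷ xs) ys f = trans (Σ-++ (List.map (g x) ys) _ f) (cong₂ _+_ (Σ-map (g x) ys f) (Σ-product g xs ys f))

  Σ-*ˡ : ∀ c (f : X → ℚ) xs → Σ[ xs ] (λ x → c * f x) ≡ c * Σ[ xs ] f
  Σ-*ˡ c f []       = sym (ℚ.*-zeroʳ c)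
  Σ-*ˡ c f (x ∷ xs) = trans (cong (c * f x +_) (Σ-*ˡ c f xs)) (sym (ℚ.*-distribˡ-+ c (f x) _))

  Σ-*ʳ : ∀ c (f : X → ℚ) xs → Σ[ xs ] (λ x → f x * c) ≡ Σ[ xs ] f * c
  Σ-*ʳ c f xs = trans (Σ-cong (λ x → ℚ.*-comm (f x) c) xs) (trans (Σ-*ˡ c f xs) (ℚ.*-comm c _))

  Σ-+ : ∀ (f g : X → ℚ) xs → Σ[ xs ] (λ x → f x + g x) ≡ Σ[ xs ] f + Σ[ xs ] g
  Σ-+ f g []       = refl
  Σ-+ f g (x ∷ xs) = trans (cong (f x + g x +_) (Σ-+ f g xs))
    (solve 4 (λ a b c d → (a :+ b) :+ (c :+ d) := (a :+ c) :+ (b :+ d)) refl (f x) (g x) (Σ[ xs ] f) (Σ[ xs ] g))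

  Σ-zero : ∀ (xs : List X) → Σ[ xs ] (λ _ → 0ℚ) ≡ 0ℚ
  Σ-zero []       = refl
  Σ-zero (x ∷ xs) = trans (ℚ.+-identityˡ _) (Σ-zero xs)

  Σ-swap : ∀ (f : X → Y → ℚ) xs ys → Σ[ xs ] (λ x → Σ[ ys ] (f x)) ≡ Σ[ ys ] (λ y → Σ[ xs ] λ x → f x y)
  Σ-swap f []       ys = sym (Σ-zero ys)
  Σ-swap f (x ∷ xs) ys = trans (cong (Σ[ ys ] (f x) +_) (Σ-swap f xs ys)) (sym (Σ-+ (f x) _ ys))

  Σ-∈ : ∀ {f : X → ℚ} → (∀ x → 0ℚ ≤ f x) → ∀ {x xs} → x ∈ xs → f x ≤ Σ[ xs ] f
  Σ-∈ {f = f} 0≤f {x} {_ ∷ xs} (here refl) = ≤-by (Σ[ xs ] f) (Σ-nonneg 0≤f xs) refl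
  Σ-∈ {f = f} 0≤f {x} {y ∷ xs} (there x∈) = ℚ.≤-trans (Σ-∈ 0≤f x∈) (≤-by (f y) (0≤f y) (ℚ.+-comm (f y) _))

  Σ-const : ∀ c (xs : List X) → Σ[ xs ] (λ _ → c) ≡ ι (length xs) * c
  Σ-const c []       = sym (trans (cong (_* c) ι0≡0) (ℚ.*-zeroˡ c))
  Σ-const c (x ∷ xs) = begin
    c + Σ[ xs ] (λ _ → c)       ≡⟨ cong (c +_) (Σ-const c xs) ⟩
    c + ι (length xs) * c       ≡⟨ solve 2 (λ c l → c :+ l :* c := (con 1ℚ :+ l) :* c) refl c (ι (length xs)) ⟩
    (1ℚ + ι (length xs)) * c    ≡⟨ cong (_* c) (ι-suc (length xs)) ⟨
    ι (suc (length xs)) * c     ∎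
    where open ≡-Reasoning

  Σ-filter : ∀ (α : X → Bool) (f : X → ℚ) xs → Σ[ filterᵇ α xs ] f ≡ Σ[ xs ] (λ x → ⟦ α x ⟧ * f x)
  Σ-filter α f []       = refl
  Σ-filter α f (x ∷ xs) with α x
  ... | true  = cong₂ _+_ (sym (ℚ.*-identityˡ (f x))) (Σ-filter α f xs)
  ... | false = trans (Σ-filter α f xs) (sym (trans (cong (_+ _) (ℚ.*-zeroˡ (f x))) (ℚ.+-identityˡ _)))

  length-as-Σ : ∀ (xs : List X) → ι (length xs) ≡ Σ[ xs ] (λ _ → 1ℚ)
  length-as-Σ xs = sym (trans (Σ-const 1ℚ xs) (ℚ.*-identityʳ _))

-- Orbits of a map of the unit interval that lies below the diagonal
module Iteration where

  open import Data.Rational.Base using (_+_; _*_; _-_; -_; _≤_; _<_; _⊔_)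
  open Defs using (Cauchy)
  open Rationals

  drop-zero : ∀ a ε → a + ι 0 * ε ≡ a
  drop-zero a ε = trans (cong (λ x → a + x * ε) ι0≡0) (solve 2 (λ a e → a :+ con 0ℚ :* e := a) refl a ε)

  -- If b is at least j drops of ε below 1 and a is another one below b, then a is j + 1
  -- drops below 1.
  drop-suc : ∀ a b j ε → a + ε ≤ b → b + ι j * ε ≤ 1ℚ → a + ι (suc j) * ε ≤ 1ℚ
  drop-suc a b j ε h k = begin
    a + ι (suc j) * ε      ≡⟨ cong (λ x → a + x * ε) (ι-suc j) ⟩
    a + (1ℚ + ι j) * ε     ≡⟨ solve 3 (λ a i e → a :+ (con 1ℚ :+ i) :* e := (a :+ e) :+ i :* e) refl a (ι j) ε ⟩
    (a + ε) + ι j * ε      ≤⟨ ℚ.+-monoˡ-≤ (ι j * ε) h ⟩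
    b + ι j * ε            ≤⟨ k ⟩
    1ℚ                     ∎
    where open ℚ.≤-Reasoning

  -- Bounded monotone sequences are Cauchy in the double-negated sense: otherwise
  -- the sequence would drop by ε more often than the unit interval has room for.
  antitone⇒Cauchy : ∀ (s : ℕ → ℚ) → (∀ m → InUnit (s m)) → (∀ m → s (suc m) ≤ s m) → Cauchy s
  antitone⇒Cauchy s unit step ε 0<ε ¬c =
    drops (suc j) λ (N , below) → <⇒≱ 0<ε
      (≤-by ((1ℚ - (s N + ι (suc j) * ε)) + s N + (ι j * ε - 1ℚ))
        (0≤+ (0≤+ (0≤- below) (proj₁ (unit N))) (0≤- 1≤jε))
        (trans
          (solve 3 (λ s i e → con 0ℚ := e :+ ((con 1ℚ :- (s :+ (con 1ℚ :+ i) :* e)) :+ s :+ (i :* e :- con 1ℚ)))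
            refl (s N) (ι j) ε)
          (cong (λ x → ε + ((1ℚ - (s N + x * ε)) + s N + (ι j * ε - 1ℚ))) (sym (ι-suc j)))))
    where
    j = proj₁ (archimedean 0<ε)
    1≤jε = proj₂ (archimedean 0<ε)
    -- Since s is not Cauchy for ε, it drops by ε arbitrarily often.
    drops : ∀ j → ¬ ¬ (∃ λ N → s N + ι j * ε ≤ 1ℚ)
    drops zero ¬d = ¬d (0 , ℚ.≤-trans (ℚ.≤-reflexive (drop-zero (s 0) ε)) (proj₂ (unit 0)))
    drops (suc j) ¬d = drops j λ (N , below) →
      ¬c (N , λ m n m≥ n≥ → ∣∣≤ (close N below m n m≥)
        (subst (_≤ ε) (solve 2 (λ a b → b :- a := :- (a :- b)) refl (s m) (s n)) (close N below n m n≥)))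
      where
      -- Unless s drops by ε below s N, all its later values are within ε of each other.
      close : ∀ N → s N + ι j * ε ≤ 1ℚ → ∀ m n → m ℕ.≥ N → s m - s n ≤ ε
      close N below m n m≥ with (s n + ε) ℚ.≤? s N
      ... | yes drop = contradiction (n , drop-suc (s n) (s N) j ε drop below) ¬d
      ... | no ¬drop = ≤-by ((s n + ε - s N) + (s N - s m))
        (0≤+ (0≤- (ℚ.<⇒≤ (ℚ.≰⇒> ¬drop))) (0≤- (antitone s step m≥)))
        (solve 4 (λ sn t sm e → e := (sm :- sn) :+ ((sn :+ e :- t) :+ (t :- sm))) refl (s n) (s N) (s m) ε)

  -- A decreasing sequence that drops by ε at each step from N on, unless it
  -- reaches lo, does reach lo.
  reaches : ∀ (s : ℕ → ℚ) → (∀ m → InUnit (s m)) → (∀ m → s (suc m) ≤ s m) →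
    ∀ lo ε N → 0ℚ < lo → 0ℚ < ε →
    (∀ m → m ℕ.≥ N → s (suc m) ≤ lo ⊎ s (suc m) + ε ≤ s m) → ∃ λ M → s M ≤ lo
  reaches s unit step lo ε N 0<lo 0<ε drop with archimedean 0<ε
  ... | j , 1≤jε = j ℕ.+ N , end (falls j)
    where
    falls : ∀ j → s (j ℕ.+ N) ≤ lo ⊎ s (j ℕ.+ N) + ι j * ε ≤ 1ℚ
    falls zero = inj₂ (ℚ.≤-trans (ℚ.≤-reflexive (drop-zero (s N) ε)) (proj₂ (unit N)))
    falls (suc j) with falls j | drop (j ℕ.+ N) (ℕ.m≤n+m N j)
    ... | inj₁ h | _      = inj₁ (ℚ.≤-trans (step (j ℕ.+ N)) h)
    ... | inj₂ _ | inj₁ h = inj₁ h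
    ... | inj₂ h | inj₂ k = inj₂ (drop-suc (s (suc (j ℕ.+ N))) (s (j ℕ.+ N)) j ε k h)
    end : s (j ℕ.+ N) ≤ lo ⊎ s (j ℕ.+ N) + ι j * ε ≤ 1ℚ → s (j ℕ.+ N) ≤ lo
    end (inj₁ h) = h
    end (inj₂ h) = ℚ.≤-trans
      (≤-by ((1ℚ - (s (j ℕ.+ N) + ι j * ε)) + (ι j * ε - 1ℚ)) (0≤+ (0≤- h) (0≤- 1≤jε))
        (solve 2 (λ s x → con 0ℚ := s :+ ((con 1ℚ :- (s :+ x)) :+ (x :- con 1ℚ))) refl (s (j ℕ.+ N)) (ι j * ε)))
      (ℚ.<⇒≤ 0<lo)

  -- The orbit of p under F: its i-th point is F applied i times to p.
  orbit : (ℚ → ℚ) → ℚ → ℕ → ℚ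
  orbit F p = fold p F

  orbit-InUnit : ∀ {F} → (∀ {p} → InUnit p → InUnit (F p)) → ∀ {p} → InUnit p → ∀ i → InUnit (orbit F p i)
  orbit-InUnit F-unit u zero    = u
  orbit-InUnit F-unit u (suc i) = F-unit (orbit-InUnit F-unit u i)

  -- A monotone map F of the unit interval below the identity.  The hypothesis gap
  -- says that F r < r for every real r strictly between 0 and 1, in the form in
  -- which it is available for the real represented by a rational sequence s.
  module _
    (F : ℚ → ℚ)
    (F-unit : ∀ {p} → InUnit p → InUnit (F p))
    (F-mono : ∀ {p q} → InUnit p → InUnit q → p ≤ q → F p ≤ F q)
    (F-decr : ∀ {p} → InUnit p → F p ≤ p)
    (gap : ∀ (s : ℕ → ℚ) → Cauchy s → ∀ lo hi → 0ℚ < lo → hi < 1ℚ → (∀ m → lo ≤ s m × s m ≤ hi) →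
           ∃ λ ε → 0ℚ < ε × ∃ λ N → ∀ m → m ℕ.≥ N → F (s m) + ε ≤ s m)
    where

    private
      orbit-unit : ∀ {p} → InUnit p → ∀ i → InUnit (orbit F p i)
      orbit-unit = orbit-InUnit F-unit

    orbit-mono : ∀ {p q} → InUnit p → InUnit q → p ≤ q → ∀ i → orbit F p i ≤ orbit F q i
    orbit-mono up uq p≤q zero    = p≤q
    orbit-mono up uq p≤q (suc i) = F-mono (orbit-unit up i) (orbit-unit uq i) (orbit-mono up uq p≤q i)

    orbit-antitone : ∀ {p} → InUnit p → ∀ {i j} → i ℕ.≤ j → orbit F p j ≤ orbit F p i
    orbit-antitone {p} u = antitone (orbit F p) λ i → F-decr (orbit-unit u i)

    -- The orbit of hi reaches any positive lo.  It stays below the sequence s with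
    -- s 0 = hi and s (m + 1) = max (F (s m)) lo, to which gap applies because all its
    -- terms are at least lo.  The resulting ε is a bound from below on each further
    -- drop of s until lo is reached.
    descend : ∀ lo hi → 0ℚ < lo → lo ≤ hi → hi < 1ℚ → ∃ λ N → orbit F hi N ≤ lo
    descend lo hi 0<lo lo≤hi hi<1 = proj₁ s-reaches , ℚ.≤-trans (orbit≤s (proj₁ s-reaches)) (proj₂ s-reaches)
      where
      s : ℕ → ℚ
      s = fold hi (λ p → F p ⊔ lo)
      lo≤s : ∀ m → lo ≤ s m
      lo≤s zero    = lo≤hi
      lo≤s (suc m) = ℚ.p≤q⊔p (F (s m)) lo
      s≤hi : ∀ m → s m ≤ hi
      s-unit : ∀ m → InUnit (s m)
      s-unit m = ℚ.≤-trans (ℚ.<⇒≤ 0<lo) (lo≤s m) , ℚ.≤-trans (s≤hi m) (ℚ.<⇒≤ hi<1)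
      s-step : ∀ m → s (suc m) ≤ s m
      s-step m = ℚ.⊔-lub (F-decr (s-unit m)) (lo≤s m)
      s≤hi zero    = ℚ.≤-refl
      s≤hi (suc m) = ℚ.≤-trans (s-step m) (s≤hi m)
      hi-unit : InUnit hi
      hi-unit = s-unit 0
      orbit≤s : ∀ m → orbit F hi m ≤ s m
      orbit≤s zero    = ℚ.≤-refl
      orbit≤s (suc m) = ℚ.≤-trans (F-mono (orbit-unit hi-unit m) (s-unit m) (orbit≤s m)) (ℚ.p≤p⊔q (F (s m)) lo)
      drop : ∀ {ε N} → (∀ m → m ℕ.≥ N → F (s m) + ε ≤ s m) →
        ∀ m → m ℕ.≥ N → s (suc m) ≤ lo ⊎ s (suc m) + ε ≤ s m
      drop {ε} fall m m≥ with ℚ.≤-total (F (s m)) lo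
      ... | inj₁ F≤lo = inj₁ (ℚ.≤-reflexive (ℚ.p≤q⇒p⊔q≡q F≤lo))
      ... | inj₂ F≥lo = inj₂ (subst (λ x → x + ε ≤ s m) (sym (ℚ.p≥q⇒p⊔q≡p F≥lo)) (fall m m≥))
      s-reaches : ∃ λ N → s N ≤ lo
      s-reaches = let ε , 0<ε , N , fall = gap s (antitone⇒Cauchy s s-unit s-step) lo hi 0<lo hi<1 (λ m → lo≤s m , s≤hi m)
                  in reaches s s-unit s-step lo ε N 0<lo 0<ε (drop fall)

    -- F is quadratically small near 0, and F (1 - q) is at least 3/2 times as far
    -- from 1 as 1 - q for small q.
    module _
      (η δ : ℚ) (0<η : 0ℚ < η) (η≤1 : η ≤ 1ℚ) (0<δ : 0ℚ < δ) (δ≤½ : δ ≤ ½)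
      (near0 : ∀ {p} → InUnit p → η * F p ≤ p * p)
      (near1 : ∀ {q} → InUnit q → q ≤ δ → ℤ.+ 3 / 2 * q ≤ 1ℚ - F (1ℚ - q))
      where

      private
        ∁∁ : ∀ p → 1ℚ - (1ℚ - p) ≡ p
        ∁∁ = solve 1 (λ p → con 1ℚ :- (con 1ℚ :- p) := p) refl

        ∁-anti : ∀ {a b} → a ≤ b → 1ℚ - b ≤ 1ℚ - a
        ∁-anti {a} {b} a≤b = ≤-by (b - a) (0≤- a≤b) (solve 2 (λ a b → con 1ℚ :- a := (con 1ℚ :- b) :+ (b :- a)) refl a b)

      growth-near-1 : ∀ {p} → InUnit p → δ ≤ 1ℚ - p ⊎ ℤ.+ 3 / 2 * (1ℚ - p) ≤ 1ℚ - F p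
      growth-near-1 {p} u with ℚ.≤-total δ (1ℚ - p)
      ... | inj₁ h = inj₁ h
      ... | inj₂ h = inj₂ (subst (λ x → ℤ.+ 3 / 2 * (1ℚ - p) ≤ 1ℚ - F x) (∁∁ p) (near1 (∁-InUnit u) h))

      -- Two steps suffice to double the distance to 1, since (3/2)² ≥ 2.
      doubling : ∀ {p} → InUnit p → δ ≤ 1ℚ - F (F p) ⊎ ℤ.+ 2 / 1 * (1ℚ - p) ≤ 1ℚ - F (F p)
      doubling {p} u with growth-near-1 u | growth-near-1 (F-unit u)
      ... | inj₁ h | _      = inj₁ (ℚ.≤-trans h (∁-anti (ℚ.≤-trans (F-decr (F-unit u)) (F-decr u))))
      ... | inj₂ _ | inj₁ h = inj₁ (ℚ.≤-trans h (∁-anti (F-decr (F-unit u))))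
      ... | inj₂ h | inj₂ k = inj₂ (≤-by
        ((1ℚ - F (F p) - ℤ.+ 3 / 2 * (1ℚ - F p)) + ℤ.+ 3 / 2 * (1ℚ - F p - ℤ.+ 3 / 2 * (1ℚ - p)) + ℤ.+ 1 / 4 * (1ℚ - p))
        (0≤+ (0≤+ (0≤- k) (0≤* (ℚ.nonNegative⁻¹ (ℤ.+ 3 / 2)) (0≤- h))) (0≤* (ℚ.nonNegative⁻¹ (ℤ.+ 1 / 4)) (0≤- (proj₂ u))))
        (solve 3 (λ a b c → c := con (ℤ.+ 2 / 1) :* a :+
            ((c :- con (ℤ.+ 3 / 2) :* b) :+ con (ℤ.+ 3 / 2) :* (b :- con (ℤ.+ 3 / 2) :* a) :+ con (ℤ.+ 1 / 4) :* a))
          refl (1ℚ - p) (1ℚ - F p) (1ℚ - F (F p))))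

      -- After 2l steps the distance to 1 is at least δ or has grown by the factor 2^l.
      escape : ∀ {p} → InUnit p → ∀ l → δ ≤ 1ℚ - orbit F p (l ℕ.* 2) ⊎ ι (2 ^ l) * (1ℚ - p) ≤ 1ℚ - orbit F p (l ℕ.* 2)
      escape {p} u zero = inj₂ (ℚ.≤-reflexive (trans (cong (_* (1ℚ - p)) ι1≡1) (ℚ.*-identityˡ (1ℚ - p))))
      escape {p} u (suc l) with doubling (orbit-unit u (l ℕ.* 2)) | escape u l
      ... | inj₁ h | _      = inj₁ h
      ... | inj₂ _ | inj₁ h = inj₁ (ℚ.≤-trans h (∁-anti (orbit-antitone u (ℕ.m≤n+m (l ℕ.* 2) 2))))
      ... | inj₂ h | inj₂ k = inj₂ (begin
        ι (2 ℕ.* 2 ^ l) * (1ℚ - p)             ≡⟨ cong (_* (1ℚ - p)) (trans (ι-* 2 (2 ^ l)) (cong (_* ι (2 ^ l)) (ι-def 2))) ⟩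
        ℤ.+ 2 / 1 * ι (2 ^ l) * (1ℚ - p)       ≡⟨ ℚ.*-assoc (ℤ.+ 2 / 1) (ι (2 ^ l)) (1ℚ - p) ⟩
        ℤ.+ 2 / 1 * (ι (2 ^ l) * (1ℚ - p))     ≤⟨ *-monoʳ-≤ (ℤ.+ 2 / 1) (ℚ.nonNegative⁻¹ (ℤ.+ 2 / 1)) k ⟩
        ℤ.+ 2 / 1 * (1ℚ - orbit F p (l ℕ.* 2)) ≤⟨ h ⟩
        1ℚ - orbit F p (2 ℕ.+ l ℕ.* 2)         ∎)
        where open ℚ.≤-Reasoning

      -- By near0 the quotient of the orbit by η is at most squared at each step.
      squaring : ∀ {p} → InUnit p → p ≤ η * ½ → ∀ j → orbit F p j ≤ η * ½ ^ℚ (2 ^ j)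
      squaring u h zero = h
      squaring {p} u h (suc j) = *-cancelˡ-≤ 0<η (begin
        η * F pⱼ                          ≤⟨ near0 (orbit-unit u j) ⟩
        pⱼ * pⱼ                           ≤⟨ *-mono-≤ (proj₁ (orbit-unit u j)) (ℚ.≤-trans (proj₁ (orbit-unit u j)) ih) ih ih ⟩
        (η * x) * (η * x)                 ≡⟨ solve 2 (λ e x → (e :* x) :* (e :* x) := e :* (e :* (x :* x))) refl η x ⟩
        η * (η * (x * x))                 ≡⟨ cong (λ y → η * (η * y)) (^-homo-* ½ (2 ^ j) (2 ^ j)) ⟨
        η * (η * ½ ^ℚ (2 ^ j ℕ.+ 2 ^ j))  ≡⟨ cong (λ y → η * (η * ½ ^ℚ (2 ^ j ℕ.+ y))) (ℕ.+-identityʳ (2 ^ j)) ⟨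
        η * (η * ½ ^ℚ (2 ^ suc j))        ∎)
        where
        open ℚ.≤-Reasoning
        pⱼ = orbit F p j
        x = ½ ^ℚ (2 ^ j)
        ih = squaring u h j

      -- The orbit of 1 - 1/n takes 2l steps to get below 1 - δ if n ≤ 2^l, then a constant
      -- number N of steps to get below η/2, and l + 2 squarings to get below the (4·2^l)-th
      -- power of one half.  Since c = N + 1, the number of steps is 3l + c + 1.
      orbit-decay : ∃ λ c → ∀ (n : ℕ) .{{_ : NonZero n}} l → n ℕ.≤ 2 ^ l → ∀ i → 3 ℕ.* l ℕ.+ suc c ℕ.≤ i →
        orbit F (1ℚ - ℤ.+ 1 / n) i ≤ ½ ^ℚ (2 ^ l ℕ.* 4)
      orbit-decay = suc N , λ n l n≤2^l i i≥ →
        let p₀ = 1ℚ - ℤ.+ 1 / n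
            u₀ = ∁-InUnit (ℚ.<⇒≤ (0<1/ n) , 1/≤1 n)
            p₁ = orbit F p₀ (l ℕ.* 2)
            u₁ = orbit-unit u₀ (l ℕ.* 2)
            p₁≤ = phase₁ n l n≤2^l
            p₂ = orbit F p₁ N
            u₂ = orbit-unit u₁ N
            p₂≤ = ℚ.≤-trans (orbit-mono u₁ hi-unit p₁≤ N) (proj₂ middle)
        in begin
        orbit F p₀ i                                   ≤⟨ orbit-antitone u₀ (subst (ℕ._≤ i) (count l N) i≥) ⟩
        orbit F p₀ ((2 ℕ.+ l) ℕ.+ (N ℕ.+ l ℕ.* 2))     ≡⟨ fold-+ p₀ F (2 ℕ.+ l) ⟩
        orbit F (orbit F p₀ (N ℕ.+ l ℕ.* 2)) (2 ℕ.+ l) ≡⟨ cong (λ p → orbit F p (2 ℕ.+ l)) (fold-+ p₀ F N) ⟩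
        orbit F p₂ (2 ℕ.+ l)                           ≤⟨ squaring u₂ p₂≤ (2 ℕ.+ l) ⟩
        η * ½ ^ℚ (2 ^ (2 ℕ.+ l))                       ≤⟨ *-mono-≤ (ℚ.<⇒≤ 0<η) (0≤½^ (2 ^ (2 ℕ.+ l))) η≤1 ℚ.≤-refl ⟩
        1ℚ * ½ ^ℚ (2 ^ (2 ℕ.+ l))                      ≡⟨ ℚ.*-identityˡ _ ⟩
        ½ ^ℚ (2 ^ (2 ℕ.+ l))                           ≡⟨ cong (½ ^ℚ_) (four l) ⟩
        ½ ^ℚ (2 ^ l ℕ.* 4)                             ∎
        where
        open ℚ.≤-Reasoning
        1-δ<1 : 1ℚ - δ < 1ℚ
        1-δ<1 = subst (1ℚ - δ <_) (solve 1 (λ d → (con 1ℚ :- d) :+ d := con 1ℚ) refl δ)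
          (subst (_< (1ℚ - δ) + δ) (ℚ.+-identityʳ (1ℚ - δ)) (ℚ.+-monoʳ-< (1ℚ - δ) 0<δ))
        ½η≤1-δ : η * ½ ≤ 1ℚ - δ
        ½η≤1-δ = ≤-by ((½ - δ) + ½ * (1ℚ - η)) (0≤+ (0≤- δ≤½) (0≤* (ℚ.nonNegative⁻¹ ½) (0≤- η≤1)))
          (solve 2 (λ d e → con 1ℚ :- d := e :* con ½ :+ ((con ½ :- d) :+ con ½ :* (con 1ℚ :- e))) refl δ η)
        middle = descend (η * ½) (1ℚ - δ) (0<* 0<η (ℚ.positive⁻¹ ½)) ½η≤1-δ 1-δ<1
        N = proj₁ middle
        hi-unit : InUnit (1ℚ - δ)
        hi-unit = ℚ.≤-trans (ℚ.<⇒≤ (0<* 0<η (ℚ.positive⁻¹ ½))) ½η≤1-δ , ℚ.<⇒≤ 1-δ<1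
        phase₁ : ∀ n .{{_ : NonZero n}} l → n ℕ.≤ 2 ^ l → orbit F (1ℚ - ℤ.+ 1 / n) (l ℕ.* 2) ≤ 1ℚ - δ
        phase₁ n l n≤2^l = subst (_≤ 1ℚ - δ) (∁∁ _) (∁-anti (case (escape (∁-InUnit (ℚ.<⇒≤ (0<1/ n) , 1/≤1 n)) l)))
          where
          q = 1ℚ - orbit F (1ℚ - ℤ.+ 1 / n) (l ℕ.* 2)
          case : δ ≤ q ⊎ ι (2 ^ l) * (1ℚ - (1ℚ - ℤ.+ 1 / n)) ≤ q → δ ≤ q
          case (inj₁ h) = h
          case (inj₂ h) = begin
            δ                                       ≤⟨ δ≤½ ⟩
            ½                                       ≤⟨ ≤-by ½ (ℚ.nonNegative⁻¹ ½) refl ⟩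
            1ℚ                                      ≡⟨ 1/*ι n ⟨
            (ℤ.+ 1 / n) * ι n                       ≤⟨ *-monoʳ-≤ (ℤ.+ 1 / n) (ℚ.<⇒≤ (0<1/ n)) (ι-mono n≤2^l) ⟩
            (ℤ.+ 1 / n) * ι (2 ^ l)                 ≡⟨ ℚ.*-comm (ℤ.+ 1 / n) (ι (2 ^ l)) ⟩
            ι (2 ^ l) * (ℤ.+ 1 / n)                 ≡⟨ cong (ι (2 ^ l) *_) (∁∁ (ℤ.+ 1 / n)) ⟨
            ι (2 ^ l) * (1ℚ - (1ℚ - ℤ.+ 1 / n))     ≤⟨ h ⟩
            q                                       ∎
        count : ∀ l N → 3 ℕ.* l ℕ.+ suc (suc N) ≡ (2 ℕ.+ l) ℕ.+ (N ℕ.+ l ℕ.* 2)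
        count = ℕ-Solver.solve-∀
        four : ∀ l → 2 ^ (2 ℕ.+ l) ≡ 2 ^ l ℕ.* 4
        four l = trans (ℕ.^-distribˡ-+-* 2 2 l) (ℕ.*-comm 4 (2 ^ l))

-- The characteristic polynomial as a function on the rationals
module Polynomial where

  open import Data.Rational.Base using (_+_; _*_; _-_; -_; _≤_; _<_; ∣_∣)
  open Defs hiding (_+_; _*_; _-_; -_; _<_; _≤_; ∣_∣)
  open Rationals
  open Sums

  -- The probability that α is true when each argument is independently true with
  -- probability p, computed by conditioning on the first argument.
  prob : ∀ {k} → BoolFun k → ℚ → ℚ
  prob {zero}  α p = ⟦ α [] ⟧
  prob {suc k} α p = p * prob (α ∘ (true ∷_)) p + (1ℚ - p) * prob (α ∘ (false ∷_)) p

  Σ-assignments : ∀ k (f : Vec Bool (suc k) → ℚ) →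
    Σ[ assignments (suc k) ] f ≡ Σ[ assignments k ] (f ∘ (true ∷_)) + Σ[ assignments k ] (f ∘ (false ∷_))
  Σ-assignments k f = trans (Σ-product _∷_ (true ∷ false ∷ []) (assignments k) f)
    (cong (Σ[ assignments k ] (f ∘ (true ∷_)) +_) (ℚ.+-identityʳ _))

  private
    seq-sumℝ : ∀ {X : Set} (f : X → ℝ) xs m → seq (sumℝ (List.map f xs)) m ≡ Σ[ xs ] (λ x → seq (f x) m)
    seq-sumℝ f []       m = refl
    seq-sumℝ f (x ∷ xs) m = cong (seq (f x) m +_) (seq-sumℝ f xs m)

  -- The characteristic polynomial acts termwise on rational sequences.
  seq-A : ∀ {k} (α : BoolFun k) p m → seq (A α p) m ≡ prob α (seq p m)
  seq-A {k} α p m = trans (seq-sumℝ (probability p) (filterᵇ α (assignments k)) m)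
    (trans (Σ-filter α pr (assignments k)) (go α))
    where
    pr : ∀ {k} → Vec Bool k → ℚ
    pr x = seq (probability p x) m
    r = seq p m
    go : ∀ {k} (α : BoolFun k) → Σ[ assignments k ] (λ x → ⟦ α x ⟧ * pr x) ≡ prob α r
    go {zero} α = trans (ℚ.+-identityʳ _) (ℚ.*-identityʳ _)
    go {suc k} α = begin
      Σ[ assignments (suc k) ] (λ x → ⟦ α x ⟧ * pr x)
        ≡⟨ Σ-assignments k _ ⟩
      Σ[ assignments k ] (λ x → ⟦ α (true ∷ x) ⟧ * (r * pr x))
        + Σ[ assignments k ] (λ x → ⟦ α (false ∷ x) ⟧ * ((1ℚ - r) * pr x))
        ≡⟨ cong₂ _+_ (slice true r) (slice false (1ℚ - r)) ⟩
      r * prob (α ∘ (true ∷_)) r + (1ℚ - r) * prob (α ∘ (false ∷_)) r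
        ∎
      where
      open ≡-Reasoning
      slice : ∀ b c → Σ[ assignments k ] (λ x → ⟦ α (b ∷ x) ⟧ * (c * pr x)) ≡ c * prob (α ∘ (b ∷_)) r
      slice b c = begin
        Σ[ assignments k ] (λ x → ⟦ α (b ∷ x) ⟧ * (c * pr x))
          ≡⟨ Σ-cong (λ x → solve 3 (λ a c p → a :* (c :* p) := c :* (a :* p)) refl ⟦ α (b ∷ x) ⟧ c (pr x)) (assignments k) ⟩
        Σ[ assignments k ] (λ x → c * (⟦ α (b ∷ x) ⟧ * pr x))
          ≡⟨ Σ-*ˡ c _ (assignments k) ⟩
        c * Σ[ assignments k ] (λ x → ⟦ α (b ∷ x) ⟧ * pr x)
          ≡⟨ cong (c *_) (go (α ∘ (b ∷_))) ⟩
        c * prob (α ∘ (b ∷_)) r ∎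

  prob-unit : ∀ {k} (α : BoolFun k) {p} → InUnit p → InUnit (prob α p)
  prob-unit {zero}  α u = ⟦⟧-unit (α [])
  prob-unit {suc k} α {p} u@(0≤p , p≤1) =
    0≤+ (0≤* 0≤p (proj₁ t)) (0≤* (0≤- p≤1) (proj₁ f)) ,
    ≤-by (p * (1ℚ - a) + (1ℚ - p) * (1ℚ - b)) (0≤+ (0≤* 0≤p (0≤- (proj₂ t))) (0≤* (0≤- p≤1) (0≤- (proj₂ f))))
      (solve 3 (λ p a b → con 1ℚ :=
        (p :* a :+ (con 1ℚ :- p) :* b) :+ (p :* (con 1ℚ :- a) :+ (con 1ℚ :- p) :* (con 1ℚ :- b)))
      refl p a b)
    where
    a = prob (α ∘ (true ∷_)) p
    b = prob (α ∘ (false ∷_)) p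
    t = prob-unit (α ∘ (true ∷_)) u
    f = prob-unit (α ∘ (false ∷_)) u

  prob-cong : ∀ {k} {α γ : BoolFun k} → α ≗ γ → ∀ p → prob α p ≡ prob γ p
  prob-cong {zero}  h p = cong ⟦_⟧ (h [])
  prob-cong {suc k} h p = cong₂ (λ a b → p * a + (1ℚ - p) * b) (prob-cong (h ∘ (true ∷_)) p) (prob-cong (h ∘ (false ∷_)) p)

  prob-not : ∀ {k} (α : BoolFun k) p → prob (not ∘ α) p ≡ 1ℚ - prob α p
  prob-not {zero}  α p = ⟦not⟧ (α [])
  prob-not {suc k} α p = trans
    (cong₂ (λ a b → p * a + (1ℚ - p) * b) (prob-not (α ∘ (true ∷_)) p) (prob-not (α ∘ (false ∷_)) p))
    (solve 3 (λ p a b → p :* (con 1ℚ :- a) :+ (con 1ℚ :- p) :* (con 1ℚ :- b) :=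
        con 1ℚ :- (p :* a :+ (con 1ℚ :- p) :* b))
      refl p (prob (α ∘ (true ∷_)) p) (prob (α ∘ (false ∷_)) p))

  prob-true : ∀ {k} p → prob {k} (const true) p ≡ 1ℚ
  prob-true {zero}  p = refl
  prob-true {suc k} p = trans (cong (λ a → p * a + (1ℚ - p) * a) (prob-true {k} p))
    (solve 1 (λ p → p :* con 1ℚ :+ (con 1ℚ :- p) :* con 1ℚ := con 1ℚ) refl p)

  -- With certainty about every entry, only one assignment is left.
  prob-0-1 : ∀ {k} (α : BoolFun k) b → prob α ⟦ b ⟧ ≡ ⟦ α (Vec.replicate k b) ⟧
  prob-0-1 {zero}  α b     = refl
  prob-0-1 {suc k} α true  = trans
    (solve 2 (λ a b → con 1ℚ :* a :+ con 0ℚ :* b := a) refl (prob (α ∘ (true ∷_)) 1ℚ) (prob (α ∘ (false ∷_)) 1ℚ))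
    (prob-0-1 (α ∘ (true ∷_)) true)
  prob-0-1 {suc k} α false = trans
    (solve 2 (λ a b → con 0ℚ :* a :+ con 1ℚ :* b := b) refl (prob (α ∘ (true ∷_)) 0ℚ) (prob (α ∘ (false ∷_)) 0ℚ))
    (prob-0-1 (α ∘ (false ∷_)) false)

  true-mono : ∀ {a b} → a Bool.≤ b → a ≡ true → b ≡ true
  true-mono b≤b e = e

  ⟦⟧-mono : ∀ {a b} → a Bool.≤ b → ⟦ a ⟧ ≤ ⟦ b ⟧
  ⟦⟧-mono f≤t = 0≤1
  ⟦⟧-mono b≤b = ℚ.≤-refl

  prob-pointwise : ∀ {k} {α γ : BoolFun k} → (∀ x → α x Bool.≤ γ x) → ∀ {p} → InUnit p → prob α p ≤ prob γ p
  prob-pointwise {zero}  h u = ⟦⟧-mono (h [])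
  prob-pointwise {suc k} h {p} u@(0≤p , p≤1) = ℚ.+-mono-≤
    (*-monoʳ-≤ p 0≤p (prob-pointwise (h ∘ (true ∷_)) u))
    (*-monoʳ-≤ (1ℚ - p) (0≤- p≤1) (prob-pointwise (h ∘ (false ∷_)) u))

  restrict-mono : ∀ {k} {α : BoolFun (suc k)} → Monotone α → ∀ b → Monotone (α ∘ (b ∷_))
  restrict-mono m b x≤y = m (b≤b ∷ x≤y)

  false≤true : ∀ {k} {α : BoolFun (suc k)} → Monotone α → ∀ x → α (false ∷ x) Bool.≤ α (true ∷ x)
  false≤true m x = m (f≤t ∷ Pointwise.refl Bool.≤-refl)

  -- When p grows, both restrictions of α become likelier to be true, and the choice
  -- between them shifts to the restriction to true, which is the larger one.
  prob-mono : ∀ {k} {α : BoolFun k} → Monotone α → ∀ {p q} → InUnit p → InUnit q → p ≤ q → prob α p ≤ prob α q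
  prob-mono {zero}  m up uq p≤q = ℚ.≤-refl
  prob-mono {suc k} {α} m {p} {q} up uq p≤q = ≤-by
    (q * (a′ - a) + (1ℚ - q) * (b′ - b) + (q - p) * (a - b))
    (0≤+ (0≤+ (0≤* (proj₁ uq) (0≤- (prob-mono (restrict-mono m true) up uq p≤q)))
              (0≤* (0≤- (proj₂ uq)) (0≤- (prob-mono (restrict-mono m false) up uq p≤q))))
         (0≤* (0≤- p≤q) (0≤- (prob-pointwise (false≤true m) up))))
    (solve 6 (λ p q a b a′ b′ → q :* a′ :+ (con 1ℚ :- q) :* b′ :=
        (p :* a :+ (con 1ℚ :- p) :* b) :+ (q :* (a′ :- a) :+ (con 1ℚ :- q) :* (b′ :- b) :+ (q :- p) :* (a :- b)))
      refl p q a b a′ b′)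
    where
    a = prob (α ∘ (true ∷_)) p
    b = prob (α ∘ (false ∷_)) p
    a′ = prob (α ∘ (true ∷_)) q
    b′ = prob (α ∘ (false ∷_)) q

  -- A monotone connective that is true at the all-false assignment is constant.
  constant-true : ∀ {k} {α : BoolFun k} → Monotone α → ∀ x → weight x ≡ 0 → α x ≡ true → α ≗ const true
  constant-true m []          w e []      = e
  constant-true {α = α} m (false ∷ x) w e (b ∷ y) = constant-true (restrict-mono m b) x w (above b) y
    where
    above : ∀ b → α (b ∷ x) ≡ true
    above false = e
    above true  = true-mono (false≤true m x) e

  -- A monotone connective that is true at an assignment with at most one true entry is
  -- constant or implied by one of its arguments, and hence true with probability at least p.
  light-true⇒id≤prob : ∀ {k} {α : BoolFun k} → Monotone α → ∀ x → weight x ℕ.≤ 1 → α x ≡ true →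
    ∀ {p} → InUnit p → p ≤ prob α p
  light-true⇒id≤prob {α = α} m [] w e {p} u rewrite e = proj₂ u
  light-true⇒id≤prob {suc k} {α} m (true ∷ x) (s≤s w) e {p} u =
    ≤-by ((1ℚ - p) * b) (0≤* (0≤- (proj₂ u)) (proj₁ (prob-unit (α ∘ (false ∷_)) u)))
      (cong (_+ (1ℚ - p) * b) (trans (cong (p *_) certain) (ℚ.*-identityʳ p)))
    where
    b = prob (α ∘ (false ∷_)) p
    certain : prob (α ∘ (true ∷_)) p ≡ 1ℚ
    certain = trans (prob-cong (constant-true (restrict-mono m true) x (ℕ.n≤0⇒n≡0 w) e) p) (prob-true {k} p)
  light-true⇒id≤prob {α = α} m (false ∷ x) w e {p} u = ≤-by (p * (a - b) + (b - p))
    (0≤+ (0≤* (proj₁ u) (0≤- (prob-pointwise (false≤true m) u))) (0≤- (light-true⇒id≤prob (restrict-mono m false) x w e u)))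
    (solve 3 (λ p a b → p :* a :+ (con 1ℚ :- p) :* b := p :+ (p :* (a :- b) :+ (b :- p))) refl p a b)
    where
    a = prob (α ∘ (true ∷_)) p
    b = prob (α ∘ (false ∷_)) p

  -- A union bound: some argument has to be true.
  prob≤linear : ∀ {k} {α : BoolFun k} → (∀ x → weight x ℕ.≤ 0 → α x ≡ false) →
    ∀ {p} → InUnit p → prob α p ≤ ι k * p
  prob≤linear {zero} {α} h {p} u rewrite h [] z≤n = ℚ.≤-reflexive (sym (trans (cong (_* p) ι0≡0) (ℚ.*-zeroˡ p)))
  prob≤linear {suc k} {α} h {p} u = ℚ.≤-trans (≤-by
    (p * (1ℚ - a) + (i * p - b) + p * b)
    (0≤+ (0≤+ (0≤* (proj₁ u) (0≤- (proj₂ (prob-unit (α ∘ (true ∷_)) u)))) (0≤- (prob≤linear (λ x → h (false ∷ x)) u)))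
      (0≤* (proj₁ u) (proj₁ (prob-unit (α ∘ (false ∷_)) u))))
    (solve 4 (λ p a b i → (con 1ℚ :+ i) :* p :=
        (p :* a :+ (con 1ℚ :- p) :* b) :+ (p :* (con 1ℚ :- a) :+ (i :* p :- b) :+ p :* b))
      refl p a b i))
    (ℚ.≤-reflexive (cong (_* p) (sym (ι-suc k))))
    where
    i = ι k
    a = prob (α ∘ (true ∷_)) p
    b = prob (α ∘ (false ∷_)) p

  -- A union bound: some pair of arguments has to be true.
  prob≤quadratic : ∀ {k} {α : BoolFun k} → (∀ x → weight x ℕ.≤ 1 → α x ≡ false) →
    ∀ {p} → InUnit p → prob α p ≤ ι k * ι k * (p * p)
  prob≤quadratic {zero} {α} h {p} u rewrite h [] z≤n = 0≤* (0≤* (0≤ι 0) (0≤ι 0)) (0≤* (proj₁ u) (proj₁ u))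
  prob≤quadratic {suc k} {α} h {p} u = ℚ.≤-trans (≤-by
    (p * (i * p - a) + (i * i * (p * p) - b) + p * b + (i * (p * p) + p * p))
    (0≤+ (0≤+ (0≤+ (0≤* (proj₁ u) (0≤- (prob≤linear (λ x → h (true ∷ x) ∘ s≤s) u)))
                   (0≤- (prob≤quadratic (λ x → h (false ∷ x)) u)))
              (0≤* (proj₁ u) (proj₁ (prob-unit (α ∘ (false ∷_)) u))))
         (0≤+ (0≤* (0≤ι k) (0≤* (proj₁ u) (proj₁ u))) (0≤* (proj₁ u) (proj₁ u))))
    (solve 4 (λ p a b i → (con 1ℚ :+ i) :* (con 1ℚ :+ i) :* (p :* p) :=
        (p :* a :+ (con 1ℚ :- p) :* b) :+
        (p :* (i :* p :- a) :+ (i :* i :* (p :* p) :- b) :+ p :* b :+ (i :* (p :* p) :+ p :* p)))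
      refl p a b i))
    (ℚ.≤-reflexive (cong (λ j → j * j * (p * p)) (sym (ι-suc k))))
    where
    i = ι k
    a = prob (α ∘ (true ∷_)) p
    b = prob (α ∘ (false ∷_)) p

  -- The number of assignments of weight j at which α is true, as a rational number.
  level : ∀ {k} → ℕ → BoolFun k → ℚ
  level {k} j α = Σ[ assignments k ] λ x → ⟦ weight x ℕ.≡ᵇ j ⟧ * ⟦ α x ⟧

  level-suc : ∀ {k} j (α : BoolFun (suc k)) → level (suc j) α ≡ level j (α ∘ (true ∷_)) + level (suc j) (α ∘ (false ∷_))
  level-suc {k} j α = Σ-assignments k λ x → ⟦ weight x ℕ.≡ᵇ suc j ⟧ * ⟦ α x ⟧

  level-zero : ∀ {k} (α : BoolFun (suc k)) → level 0 α ≡ level 0 (α ∘ (false ∷_))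
  level-zero {k} α = trans (Σ-assignments k λ x → ⟦ weight x ℕ.≡ᵇ 0 ⟧ * ⟦ α x ⟧) (trans
    (cong (_+ level 0 (α ∘ (false ∷_))) (trans (Σ-cong (λ x → ℚ.*-zeroˡ ⟦ α (true ∷ x) ⟧) (assignments k)) (Σ-zero (assignments k))))
    (ℚ.+-identityˡ _))

  level-nonneg : ∀ {k} j (α : BoolFun k) → 0ℚ ≤ level j α
  level-nonneg {k} j α = Σ-nonneg (λ x → 0≤* (proj₁ (⟦⟧-unit (weight x ℕ.≡ᵇ j))) (proj₁ (⟦⟧-unit (α x)))) (assignments k)

  level-above : ∀ k {j} (α : BoolFun k) → k ℕ.< j → level j α ≡ 0ℚ
  level-above zero    {suc j} α (s≤s h) = trans (ℚ.+-identityʳ _) (ℚ.*-zeroˡ ⟦ α [] ⟧)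
  level-above (suc k) {suc j} α (s≤s h) = trans (level-suc j α)
    (cong₂ _+_ (level-above k (α ∘ (true ∷_)) h) (level-above k (α ∘ (false ∷_)) (ℕ.m<n⇒m<1+n h)))

  level-top : ∀ k → level {k} k (const true) ≡ 1ℚ
  level-top zero = refl
  level-top (suc k) = trans (level-suc {k} k (const true)) (cong₂ _+_ (level-top k) (level-above k (const true) ℕ.≤-refl))

  -- There are k + 1 assignments with exactly one false entry.
  level-cotop : ∀ k → level {suc k} k (const true) ≡ ι (suc k)
  level-cotop zero    = sym ι1≡1
  level-cotop (suc k) = trans (level-suc {suc k} k (const true))
    (trans (cong₂ _+_ (level-cotop k) (level-top (suc k))) (trans (ℚ.+-comm (ι (suc k)) 1ℚ) (sym (ι-suc (suc k)))))

  level-not : ∀ {k} j (α : BoolFun k) → level j (not ∘ α) + level j α ≡ level {k} j (const true)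
  level-not {k} j α = trans (sym (Σ-+ _ _ (assignments k))) (Σ-cong (λ x → begin
    ⟦ weight x ℕ.≡ᵇ j ⟧ * ⟦ not (α x) ⟧ + ⟦ weight x ℕ.≡ᵇ j ⟧ * ⟦ α x ⟧
      ≡⟨ cong (λ y → ⟦ weight x ℕ.≡ᵇ j ⟧ * y + ⟦ weight x ℕ.≡ᵇ j ⟧ * ⟦ α x ⟧) (⟦not⟧ (α x)) ⟩
    ⟦ weight x ℕ.≡ᵇ j ⟧ * (1ℚ - ⟦ α x ⟧) + ⟦ weight x ℕ.≡ᵇ j ⟧ * ⟦ α x ⟧
      ≡⟨ solve 2 (λ w a → w :* (con 1ℚ :- a) :+ w :* a := w :* con 1ℚ) refl ⟦ weight x ℕ.≡ᵇ j ⟧ ⟦ α x ⟧ ⟩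
    ⟦ weight x ℕ.≡ᵇ j ⟧ * 1ℚ ∎) (assignments k))
    where open ≡-Reasoning

  -- The contribution of the all-true assignment, by Bernoulli's inequality for (1 - q)^k.
  top-bound : ∀ {k} (α : BoolFun k) {q} → InUnit q → level k α * (1ℚ - ι k * q) ≤ prob α (1ℚ - q)
  top-bound {zero}  α {q} u = ℚ.≤-reflexive (begin
    (1ℚ * ⟦ α [] ⟧ + 0ℚ) * (1ℚ - ι 0 * q)  ≡⟨ cong (λ i → (1ℚ * ⟦ α [] ⟧ + 0ℚ) * (1ℚ - i * q)) ι0≡0 ⟩
    (1ℚ * ⟦ α [] ⟧ + 0ℚ) * (1ℚ - 0ℚ * q)   ≡⟨ solve 2 (λ a q → (con 1ℚ :* a :+ con 0ℚ) :* (con 1ℚ :- con 0ℚ :* q) := a) refl ⟦ α [] ⟧ q ⟩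
    ⟦ α [] ⟧                               ∎)
    where open ≡-Reasoning
  top-bound {suc k} α {q} u = begin
    level (suc k) α * (1ℚ - ι (suc k) * q)
      ≡⟨ cong₂ (λ x i → x * (1ℚ - i * q))
           (trans (level-suc k α) (cong (l +_) (level-above k (α ∘ (false ∷_)) ℕ.≤-refl))) (ι-suc k) ⟩
    (l + 0ℚ) * (1ℚ - (1ℚ + ι k) * q)
      ≤⟨ ≤-by ((1ℚ - q) * (a - l * (1ℚ - ι k * q)) + q * b + l * (ι k * (q * q)))
           (0≤+ (0≤+ (0≤* (0≤- (proj₂ u)) (0≤- (top-bound (α ∘ (true ∷_)) u)))
                     (0≤* (proj₁ u) (proj₁ (prob-unit (α ∘ (false ∷_)) (∁-InUnit u)))))
                (0≤* (level-nonneg k (α ∘ (true ∷_))) (0≤* (0≤ι k) (0≤* (proj₁ u) (proj₁ u)))))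
           (solve 5 (λ q l a b i → (con 1ℚ :- q) :* a :+ (con 1ℚ :- (con 1ℚ :- q)) :* b :=
              (l :+ con 0ℚ) :* (con 1ℚ :- (con 1ℚ :+ i) :* q) :+
              ((con 1ℚ :- q) :* (a :- l :* (con 1ℚ :- i :* q)) :+ q :* b :+ l :* (i :* (q :* q))))
            refl q l a b (ι k)) ⟩
    prob α (1ℚ - q)                          ∎
    where
    open ℚ.≤-Reasoning
    l = level k (α ∘ (true ∷_))
    a = prob (α ∘ (true ∷_)) (1ℚ - q)
    b = prob (α ∘ (false ∷_)) (1ℚ - q)

  -- The contribution of the assignments with exactly one false entry: each of them has
  -- probability q (1 - q)^k.
  cotop-bound : ∀ {k} (α : BoolFun (suc k)) {q} → InUnit q → level k α * (q * (1ℚ - ι k * q)) ≤ prob α (1ℚ - q)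
  cotop-bound {zero} α {q} u = begin
    level 0 α * (q * (1ℚ - ι 0 * q))      ≡⟨ cong₂ (λ x i → x * (q * (1ℚ - i * q))) (level-zero α) ι0≡0 ⟩
    (1ℚ * b + 0ℚ) * (q * (1ℚ - 0ℚ * q))   ≤⟨ ≤-by ((1ℚ - q) * a) (0≤* (0≤- (proj₂ u)) (proj₁ (⟦⟧-unit (α (true ∷ [])))))
        (solve 3 (λ q a b → (con 1ℚ :- q) :* a :+ (con 1ℚ :- (con 1ℚ :- q)) :* b :=
            (con 1ℚ :* b :+ con 0ℚ) :* (q :* (con 1ℚ :- con 0ℚ :* q)) :+ (con 1ℚ :- q) :* a)
          refl q a b) ⟩
    prob α (1ℚ - q)                       ∎
    where
    open ℚ.≤-Reasoning
    a = ⟦ α (true ∷ []) ⟧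
    b = ⟦ α (false ∷ []) ⟧
  cotop-bound {suc k} α {q} u = begin
    level (suc k) α * (q * (1ℚ - ι (suc k) * q))   ≡⟨ cong (_* (q * (1ℚ - ι (suc k) * q))) (level-suc k α) ⟩
    (l + l′) * (q * (1ℚ - ι (suc k) * q))          ≡⟨ cong (λ i → (l + l′) * (q * (1ℚ - i * q))) (ι-suc k) ⟩
    (l + l′) * (q * (1ℚ - (1ℚ + i) * q))
      ≤⟨ ≤-by ((1ℚ - q) * (a - l * (q * (1ℚ - i * q))) + q * (b - l′ * (1ℚ - (1ℚ + i) * q)) + l * (i * (q * (q * q))))
          (0≤+ (0≤+ (0≤* (0≤- (proj₂ u)) (0≤- (cotop-bound (α ∘ (true ∷_)) u)))
                    (0≤* (proj₁ u) (0≤- (subst (λ i → l′ * (1ℚ - i * q) ≤ b) (ι-suc k) (top-bound (α ∘ (false ∷_)) u)))))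
               (0≤* (level-nonneg k (α ∘ (true ∷_))) (0≤* (0≤ι k) (0≤* (proj₁ u) (0≤* (proj₁ u) (proj₁ u))))))
          (solve 6 (λ q l l′ a b i → (con 1ℚ :- q) :* a :+ (con 1ℚ :- (con 1ℚ :- q)) :* b :=
              (l :+ l′) :* (q :* (con 1ℚ :- (con 1ℚ :+ i) :* q)) :+
              ((con 1ℚ :- q) :* (a :- l :* (q :* (con 1ℚ :- i :* q))) :+ q :* (b :- l′ :* (con 1ℚ :- (con 1ℚ :+ i) :* q)) :+ l :* (i :* (q :* (q :* q)))))
            refl q l l′ a b i) ⟩
    prob α (1ℚ - q)                                ∎
    where
    open ℚ.≤-Reasoning
    i = ι k
    l = level k (α ∘ (true ∷_))
    l′ = level (suc k) (α ∘ (false ∷_))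
    a = prob (α ∘ (true ∷_)) (1ℚ - q)
    b = prob (α ∘ (false ∷_)) (1ℚ - q)

  ratio-*-ι : ∀ a b .{{_ : NonZero b}} → ratio a b * ι b ≡ ι a
  ratio-*-ι a b@(suc _) = /-*-ι a b

-- Connectives whose characteristic polynomial lies below the diagonal
module Connective where

  open import Data.Rational.Base using (_+_; _*_; _-_; -_; _≤_; _<_; ∣_∣)
  open Defs hiding (_+_; _*_; _-_; -_; _<_; _≤_; ∣_∣)
  open Rationals
  open Sums
  open Polynomial
  open Iteration

  0<½ : 0ℚ < ½
  0<½ = ℚ.positive⁻¹ ½

  ½<1 : ½ < 1ℚ
  ½<1 = subst (_< ½ + ½) (ℚ.+-identityʳ ½) (ℚ.+-monoʳ-< ½ 0<½)

  unit-cases : ∀ {p} → InUnit p → p ≤ 0ℚ ⊎ 1ℚ ≤ p ⊎ (0ℚ < p × p < 1ℚ)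
  unit-cases {p} u with p ℚ.≤? 0ℚ | 1ℚ ℚ.≤? p
  ... | yes p≤0 | _       = inj₁ p≤0
  ... | no _    | yes 1≤p = inj₂ (inj₁ 1≤p)
  ... | no p≰0  | no 1≰p  = inj₂ (inj₂ (ℚ.≰⇒> p≰0 , ℚ.≰⇒> 1≰p))

  weight-zeros : ∀ k → weight (Vec.replicate k false) ≡ 0
  weight-zeros zero    = refl
  weight-zeros (suc k) = weight-zeros k

  -- Consequences of the hypothesis that the characteristic polynomial lies below the identity
  -- on the open unit interval.
  module BelowDiagonal {k} (α : BoolFun k)
    (below : ∀ p → 0ℝ Defs.< p → p Defs.< 1ℝ → A α p Defs.< p) where

    -- The hypothesis at the real number represented by s, read off the representing sequences.
    gap : ∀ (s : ℕ → ℚ) → Cauchy s → ∀ lo hi → 0ℚ < lo → hi < 1ℚ → (∀ m → lo ≤ s m × s m ≤ hi) →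
      ∃ λ ε → 0ℚ < ε × ∃ λ N → ∀ m → m ℕ.≥ N → prob α (s m) + ε ≤ s m
    gap s c lo hi 0<lo hi<1 bounds =
      let ε , 0<ε , N , h = below (mkℝ s c)
            (lo , 0<lo , 0 , λ m _ → ℚ.≤-trans (ℚ.≤-reflexive (ℚ.+-identityˡ lo)) (proj₁ (bounds m)))
            (1ℚ - hi , 0<- hi<1 , 0 , λ m _ → ≤-by (hi - s m) (0≤- (proj₂ (bounds m)))
              (solve 2 (λ s h → con 1ℚ := (s :+ (con 1ℚ :- h)) :+ (h :- s)) refl (s m) hi))
      in ε , 0<ε , N , λ m m≥ → subst (λ x → x + ε ≤ s m) (seq-A α (mkℝ s c) m) (h m m≥)

    prob<id : ∀ {p} → 0ℚ < p → p < 1ℚ → prob α p < p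
    prob<id {p} 0<p p<1 =
      let ε , 0<ε , N , h = gap (const p) (cauchy (fromℚ p)) p p 0<p p<1 (λ _ → ℚ.≤-refl , ℚ.≤-refl)
      in ℚ.<-≤-trans (subst (_< prob α p + ε) (ℚ.+-identityʳ (prob α p)) (ℚ.+-monoʳ-< (prob α p) 0<ε)) (h N ℕ.≤-refl)

    module _ (mono : Monotone α) where

      -- At an assignment with at most one true entry, the value true would contradict the
      -- hypothesis at the probability one half.
      light-false : ∀ x → weight x ℕ.≤ 1 → α x ≡ false
      light-false x w = Bool.¬-not λ eq → <⇒≱ (prob<id 0<½ ½<1) (light-true⇒id≤prob mono x w eq (ℚ.<⇒≤ 0<½ , ℚ.<⇒≤ ½<1))

      zeros-false : α (Vec.replicate k false) ≡ false
      zeros-false = light-false (Vec.replicate k false) (subst (ℕ._≤ 1) (sym (weight-zeros k)) z≤n)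

      prob≤id : ∀ {p} → InUnit p → prob α p ≤ p
      prob≤id {p} u = by-cases (unit-cases u)
        where
        open ℚ.≤-Reasoning
        by-cases : p ≤ 0ℚ ⊎ 1ℚ ≤ p ⊎ (0ℚ < p × p < 1ℚ) → prob α p ≤ p
        by-cases (inj₁ p≤0) = begin
          prob α p     ≤⟨ prob≤linear (λ x w → light-false x (ℕ.≤-trans w z≤n)) u ⟩
          ι k * p      ≤⟨ *-monoʳ-≤ (ι k) (0≤ι k) p≤0 ⟩
          ι k * 0ℚ     ≡⟨ ℚ.*-zeroʳ (ι k) ⟩
          0ℚ           ≤⟨ proj₁ u ⟩
          p            ∎
        by-cases (inj₂ (inj₁ 1≤p))         = ℚ.≤-trans (proj₂ (prob-unit α u)) 1≤p
        by-cases (inj₂ (inj₂ (0<p , p<1))) = ℚ.<⇒≤ (prob<id 0<p p<1)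

  -- With at most m of the m + 2 assignments of weight m + 1 true, at least two are false.
  two-false : ∀ {m} (α : BoolFun (2 ℕ.+ m)) → β α (suc m) ≤ ratio m (2 ℕ.+ m) →
    1ℚ + 1ℚ ≤ level (suc m) (not ∘ α)
  two-false {m} α h = begin
    1ℚ + 1ℚ
      ≤⟨ ≤-by (ι m - level (suc m) α) (0≤- few) refl ⟩
    1ℚ + 1ℚ + (ι m - level (suc m) α)
      ≡⟨ solve 2 (λ i l → con 1ℚ :+ con 1ℚ :+ (i :- l) := (con 1ℚ :+ (con 1ℚ :+ i)) :- l) refl (ι m) (level (suc m) α) ⟩
    1ℚ + (1ℚ + ι m) - level (suc m) α
      ≡⟨ cong (_- level (suc m) α) (trans (ι-suc (suc m)) (cong (1ℚ +_) (ι-suc m))) ⟨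
    ι (2 ℕ.+ m) - level (suc m) α
      ≡⟨ cong (_- level (suc m) α) (trans (level-not (suc m) α) (level-cotop (suc m))) ⟨
    level (suc m) (not ∘ α) + level (suc m) α - level (suc m) α
      ≡⟨ solve 2 (λ a b → a :+ b :- b := a) refl (level (suc m) (not ∘ α)) (level (suc m) α) ⟩
    level (suc m) (not ∘ α) ∎
    where
    open ℚ.≤-Reasoning
    -- The assignments over which the fraction β is taken.
    slice = filterᵇ (λ x → weight x ℕ.≡ᵇ suc m) (assignments (2 ℕ.+ m))
    total : ι (length slice) ≡ ι (2 ℕ.+ m)
    total = trans (length-as-Σ slice) (trans (Σ-filter _ (const 1ℚ) (assignments (2 ℕ.+ m))) (level-cotop (suc m)))
    true-ones : ι (length (filterᵇ α slice)) ≡ level (suc m) α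
    true-ones = trans (length-as-Σ (filterᵇ α slice)) (trans (Σ-filter α (const 1ℚ) slice)
      (trans (Σ-cong (λ x → ℚ.*-identityʳ ⟦ α x ⟧) slice) (Σ-filter _ (λ x → ⟦ α x ⟧) (assignments (2 ℕ.+ m)))))
    ratio-as-level : ∀ a b → ι b ≡ ι (2 ℕ.+ m) → ratio a b * ι (2 ℕ.+ m) ≡ ι a
    ratio-as-level a zero      e = contradiction (subst (1ℚ ≤_) (trans (sym e) ι0≡0) (1≤ι (2 ℕ.+ m))) 1≰0
    ratio-as-level a b@(suc _) e = trans (cong (ratio a b *_) (sym e)) (ratio-*-ι a b)
    few : level (suc m) α ≤ ι m
    few = begin
      level (suc m) α                       ≡⟨ true-ones ⟨
      ι (length (filterᵇ α slice))          ≡⟨ ratio-as-level (length (filterᵇ α slice)) (length slice) total ⟨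
      β α (suc m) * ι (2 ℕ.+ m)             ≤⟨ ℚ.*-monoʳ-≤-nonNeg (ι (2 ℕ.+ m)) {{ℚ.nonNegative (0≤ι (2 ℕ.+ m))}} h ⟩
      ratio m (2 ℕ.+ m) * ι (2 ℕ.+ m)       ≡⟨ ratio-*-ι m (2 ℕ.+ m) ⟩
      ι m                                   ∎

  -- The rates at which the characteristic polynomial leaves 1 and approaches 0.
  module Rates {m} (α : BoolFun (2 ℕ.+ m)) (mono : Monotone α)
    (below : ∀ p → 0ℝ Defs.< p → p Defs.< 1ℝ → A α p Defs.< p)
    (few : β α (suc m) ≤ ratio m (2 ℕ.+ m)) where

    open BelowDiagonal α below

    private
      k = 2 ℕ.+ m
      -- The constants are η = r² and δ = r/4.
      r = ℤ.+ 1 / k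
      0≤r : 0ℚ ≤ r
      0≤r = ℚ.<⇒≤ (0<1/ k)
      rk≡1 : r * ι k ≡ 1ℚ
      rk≡1 = 1/*ι k

    near0 : ∀ {p} → InUnit p → (r * r) * prob α p ≤ p * p
    near0 {p} u = begin
      (r * r) * prob α p                 ≤⟨ *-monoʳ-≤ (r * r) (0≤* 0≤r 0≤r) (prob≤quadratic (light-false mono) u) ⟩
      (r * r) * (ι k * ι k * (p * p))    ≡⟨ solve 3 (λ r i p → (r :* r) :* (i :* i :* (p :* p)) := (r :* i) :* (r :* i) :* (p :* p)) refl r (ι k) p ⟩
      (r * ι k) * (r * ι k) * (p * p)    ≡⟨ cong (λ x → x * x * (p * p)) rk≡1 ⟩
      1ℚ * 1ℚ * (p * p)                  ≡⟨ solve 1 (λ p → con 1ℚ :* con 1ℚ :* (p :* p) := p :* p) refl p ⟩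
      p * p                              ∎
      where open ℚ.≤-Reasoning

    -- Two false assignments contribute at least 2q (1 - (k - 1) q), and (k - 1) q ≤ 1/4.
    near1 : ∀ {q} → InUnit q → q ≤ ℤ.+ 1 / 4 * r → ℤ.+ 3 / 2 * q ≤ 1ℚ - prob α (1ℚ - q)
    near1 {q} u q≤ = begin
      ℤ.+ 3 / 2 * q
        ≤⟨ ≤-by ((1ℚ + 1ℚ) * q * (ℤ.+ 1 / 4 - i * q)) (0≤* (0≤* (ℚ.nonNegative⁻¹ (1ℚ + 1ℚ)) (proj₁ u)) (0≤- iq≤))
             (solve 2 (λ q i → (con 1ℚ :+ con 1ℚ) :* (q :* (con 1ℚ :- i :* q)) :=
                con (ℤ.+ 3 / 2) :* q :+ (con 1ℚ :+ con 1ℚ) :* q :* (con (ℤ.+ 1 / 4) :- i :* q)) refl q i) ⟩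
      (1ℚ + 1ℚ) * (q * (1ℚ - i * q))
        ≤⟨ ℚ.*-monoʳ-≤-nonNeg (q * (1ℚ - i * q)) {{ℚ.nonNegative (0≤* (proj₁ u) (0≤- (ℚ.≤-trans iq≤ ¼≤1)))}} (two-false α few) ⟩
      level (suc m) (not ∘ α) * (q * (1ℚ - i * q))
        ≤⟨ cotop-bound (not ∘ α) u ⟩
      prob (not ∘ α) (1ℚ - q)
        ≡⟨ prob-not α (1ℚ - q) ⟩
      1ℚ - prob α (1ℚ - q) ∎
      where
      open ℚ.≤-Reasoning
      i = ι (suc m)
      ¼≤1 : ℤ.+ 1 / 4 ≤ 1ℚ
      ¼≤1 = 1/≤1 4
      iq≤ : i * q ≤ ℤ.+ 1 / 4
      iq≤ = begin
        i * q                       ≤⟨ *-mono-≤ (0≤ι (suc m)) (0≤* (ℚ.nonNegative⁻¹ (ℤ.+ 1 / 4)) 0≤r) (ι-mono (ℕ.n≤1+n (suc m))) q≤ ⟩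
        ι k * (ℤ.+ 1 / 4 * r)       ≡⟨ solve 2 (λ i r → i :* (con (ℤ.+ 1 / 4) :* r) := con (ℤ.+ 1 / 4) :* (r :* i)) refl (ι k) r ⟩
        ℤ.+ 1 / 4 * (r * ι k)       ≡⟨ cong (ℤ.+ 1 / 4 *_) rk≡1 ⟩
        ℤ.+ 1 / 4 * 1ℚ              ≡⟨ ℚ.*-identityʳ (ℤ.+ 1 / 4) ⟩
        ℤ.+ 1 / 4                   ∎

    decay : ∃ λ c → ∀ (n : ℕ) .{{_ : NonZero n}} l → n ℕ.≤ 2 ^ l → ∀ i → 3 ℕ.* l ℕ.+ suc c ℕ.≤ i →
      orbit (prob α) (1ℚ - ℤ.+ 1 / n) i ≤ ½ ^ℚ (2 ^ l ℕ.* 4)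
    decay = orbit-decay (prob α) (prob-unit α) (prob-mono mono) (prob≤id mono) gap (r * r) (ℤ.+ 1 / 4 * r)
      (0<* (0<1/ k) (0<1/ k))
      (ℚ.≤-trans (*-mono-≤ 0≤r 0≤1 (1/≤1 k) (1/≤1 k)) (ℚ.≤-reflexive (ℚ.*-identityˡ 1ℚ)))
      (0<* (ℚ.positive⁻¹ (ℤ.+ 1 / 4)) (0<1/ k))
      δ≤½
      near0 near1
      where
      δ≤½ : ℤ.+ 1 / 4 * r ≤ ½
      δ≤½ = ≤-by (ℤ.+ 1 / 4 * (1ℚ - r) + ℤ.+ 1 / 4)
        (0≤+ (0≤* (ℚ.nonNegative⁻¹ (ℤ.+ 1 / 4)) (0≤- (1/≤1 k))) (ℚ.nonNegative⁻¹ (ℤ.+ 1 / 4)))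
        (solve 1 (λ r → con ½ := con (ℤ.+ 1 / 4) :* r :+ (con (ℤ.+ 1 / 4) :* (con 1ℚ :- r) :+ con (ℤ.+ 1 / 4))) refl r)

-- Random functions grown from the projections
module Growth where

  open import Data.Rational.Base using (_+_; _*_; _-_; -_; _≤_; _<_; ∣_∣)
  open Defs hiding (_+_; _*_; _-_; -_; _<_; _≤_; ∣_∣)
  open Rationals
  open Sums
  open Polynomial

  -- A quantity that depends on a Boolean function only through its values.
  Extensional : ∀ {n} → (BoolFun n → ℚ) → Set
  Extensional h = ∀ {f g} → f ≗ g → h f ≡ h g

  ≗?-[] : ∀ (g f : BoolFun 0) → does (g ≗? f) ≡ does (g [] Bool.≟ f [])
  ≗?-[] g f with g [] Bool.≟ f []
  ... | yes _ = refl
  ... | no _  = refl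

  ≗?-∷ : ∀ {n} (g : BoolFun (suc n)) u v →
    does (g ≗? branch u v) ≡ does ((g ∘ (true ∷_)) ≗? u) ∧ does ((g ∘ (false ∷_)) ≗? v)
  ≗?-∷ g u v with (g ∘ (true ∷_)) ≗? u | (g ∘ (false ∷_)) ≗? v
  ... | yes _ | yes _ = refl
  ... | no _  | _     = refl
  ... | yes _ | no _  = refl

  branch-ext : ∀ {n} {u u′ v v′ : BoolFun n} → u ≗ u′ → v ≗ v′ → branch u v ≗ branch u′ v′
  branch-ext p q (true ∷ x)  = p x
  branch-ext p q (false ∷ x) = q x

  branch-η : ∀ {n} (g : BoolFun (suc n)) → branch (g ∘ (true ∷_)) (g ∘ (false ∷_)) ≗ g
  branch-η g (true ∷ x)  = refl
  branch-η g (false ∷ x) = refl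

  -- Every Boolean function occurs exactly once among the functions that are listed.
  Σ-functions : ∀ n {h : BoolFun n → ℚ} → Extensional h → ∀ g →
    Σ[ functions n ] (λ f → ⟦ does (g ≗? f) ⟧ * h f) ≡ h g
  Σ-functions zero {h} ext g = begin
    ⟦ does (g ≗? const true) ⟧ * h (const true) + (⟦ does (g ≗? const false) ⟧ * h (const false) + 0ℚ)
      ≡⟨ cong₂ (λ a b → ⟦ a ⟧ * h (const true) + (⟦ b ⟧ * h (const false) + 0ℚ)) (≗?-[] g (const true)) (≗?-[] g (const false)) ⟩
    ⟦ does (g [] Bool.≟ true) ⟧ * h (const true) + (⟦ does (g [] Bool.≟ false) ⟧ * h (const false) + 0ℚ)
      ≡⟨ only (g []) ⟩
    h (const (g []))
      ≡⟨ ext (λ { [] → refl }) ⟩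
    h g ∎
    where
    open ≡-Reasoning
    only : ∀ b → ⟦ does (b Bool.≟ true) ⟧ * h (const true) + (⟦ does (b Bool.≟ false) ⟧ * h (const false) + 0ℚ) ≡
      h (const b)
    only true  = solve 2 (λ x y → con 1ℚ :* x :+ (con 0ℚ :* y :+ con 0ℚ) := x) refl (h (const true)) (h (const false))
    only false = solve 2 (λ x y → con 0ℚ :* x :+ (con 1ℚ :* y :+ con 0ℚ) := y) refl (h (const true)) (h (const false))
  Σ-functions (suc n) {h} ext g = begin
    Σ[ functions (suc n) ] (λ f → ⟦ does (g ≗? f) ⟧ * h f)
      ≡⟨ Σ-product branch (functions n) (functions n) _ ⟩
    Σ[ functions n ] (λ u → Σ[ functions n ] λ v → ⟦ does (g ≗? branch u v) ⟧ * h (branch u v))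
      ≡⟨ Σ-cong (λ u → trans (Σ-cong (λ v → factor u v) (functions n)) (Σ-*ˡ ⟦ does (g₁ ≗? u) ⟧ _ (functions n))) (functions n) ⟩
    Σ[ functions n ] (λ u → ⟦ does (g₁ ≗? u) ⟧ * Σ[ functions n ] (λ v → ⟦ does (g₀ ≗? v) ⟧ * h (branch u v)))
      ≡⟨ Σ-cong (λ u → cong (⟦ does (g₁ ≗? u) ⟧ *_) (Σ-functions n {h ∘ branch u} (ext ∘ branch-ext {u = u} (λ _ → refl)) g₀)) (functions n) ⟩
    Σ[ functions n ] (λ u → ⟦ does (g₁ ≗? u) ⟧ * h (branch u g₀))
      ≡⟨ Σ-functions n {λ u → h (branch u g₀)} (λ e → ext (branch-ext e (λ _ → refl))) g₁ ⟩
    h (branch g₁ g₀)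
      ≡⟨ ext (branch-η g) ⟩
    h g ∎
    where
    open ≡-Reasoning
    g₁ = g ∘ (true ∷_)
    g₀ = g ∘ (false ∷_)
    factor : ∀ u v → ⟦ does (g ≗? branch u v) ⟧ * h (branch u v) ≡
      ⟦ does (g₁ ≗? u) ⟧ * (⟦ does (g₀ ≗? v) ⟧ * h (branch u v))
    factor u v = trans (cong (λ b → ⟦ b ⟧ * h (branch u v)) (≗?-∷ g u v))
      (trans (cong (_* h (branch u v)) (⟦∧⟧ (does (g₁ ≗? u)) (does (g₀ ≗? v))))
        (ℚ.*-assoc ⟦ does (g₁ ≗? u) ⟧ ⟦ does (g₀ ≗? v) ⟧ (h (branch u v))))

  -- The expectation of h under the weights ρ.
  𝔼 : ∀ {n} → (BoolFun n → ℚ) → (BoolFun n → ℚ) → ℚ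
  𝔼 {n} ρ h = Σ[ functions n ] λ f → ρ f * h f

  -- The distribution of F z, for z in the list zs with weights w.  Both the uniform
  -- distribution on the projections and each growth step are of this form.
  pushforward : ∀ {n} {Z : Set} → (Z → BoolFun n) → (Z → ℚ) → List Z → BoolFun n → ℚ
  pushforward F w zs f = Σ[ zs ] λ z → if does (F z ≗? f) then w z else 0ℚ

  𝔼-pushforward : ∀ {n} {Z : Set} (F : Z → BoolFun n) w zs {h} → Extensional h →
    𝔼 (pushforward F w zs) h ≡ Σ[ zs ] λ z → w z * h (F z)
  𝔼-pushforward {n} F w zs {h} ext = begin
    Σ[ functions n ] (λ f → pushforward F w zs f * h f)
      ≡⟨ Σ-cong (λ f → trans (sym (Σ-*ʳ (h f) _ zs)) (Σ-cong (λ z → trans (cong (_* h f) (if-⟦⟧ (does (F z ≗? f)) (w z)))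
           (solve 3 (λ d w h → d :* w :* h := w :* (d :* h)) refl ⟦ does (F z ≗? f) ⟧ (w z) (h f))) zs)) (functions n) ⟩
    Σ[ functions n ] (λ f → Σ[ zs ] λ z → w z * (⟦ does (F z ≗? f) ⟧ * h f))
      ≡⟨ Σ-swap _ (functions n) zs ⟩
    Σ[ zs ] (λ z → Σ[ functions n ] λ f → w z * (⟦ does (F z ≗? f) ⟧ * h f))
      ≡⟨ Σ-cong (λ z → trans (Σ-*ˡ (w z) _ (functions n)) (cong (w z *_) (Σ-functions n ext (F z)))) zs ⟩
    Σ[ zs ] (λ z → w z * h (F z)) ∎
    where open ≡-Reasoning

  does-≗?-ext : ∀ {n} (f : BoolFun n) {g h : BoolFun n} → g ≗ h → does (g ≗? f) ≡ does (h ≗? f)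
  does-≗?-ext f {g} {h} g≗h = does-⇔ (mk⇔ (λ e x → trans (sym (g≗h x)) (e x)) (λ e x → trans (g≗h x) (e x))) (g ≗? f) (h ≗? f)

  pushforward-as-𝔼 : ∀ {n} {Z : Set} (F : Z → BoolFun n) w zs f →
    pushforward F w zs f ≡ 𝔼 (pushforward F w zs) (λ g → ⟦ does (g ≗? f) ⟧)
  pushforward-as-𝔼 F w zs f = trans
    (Σ-cong (λ z → trans (if-⟦⟧ (does (F z ≗? f)) (w z)) (ℚ.*-comm ⟦ does (F z ≗? f) ⟧ (w z))) zs)
    (sym (𝔼-pushforward F w zs (λ e → cong ⟦_⟧ (does-≗?-ext f e))))

  𝔼-+ : ∀ {n} (ρ g h : BoolFun n → ℚ) → 𝔼 ρ (λ f → g f + h f) ≡ 𝔼 ρ g + 𝔼 ρ h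
  𝔼-+ {n} ρ g h = trans (Σ-cong (λ f → ℚ.*-distribˡ-+ (ρ f) (g f) (h f)) (functions n)) (Σ-+ _ _ (functions n))

  𝔼-*ʳ : ∀ {n} (ρ h : BoolFun n → ℚ) c → 𝔼 ρ (λ f → h f * c) ≡ 𝔼 ρ h * c
  𝔼-*ʳ {n} ρ h c = trans (Σ-cong (λ f → sym (ℚ.*-assoc (ρ f) (h f) c)) (functions n)) (Σ-*ʳ c _ (functions n))

  𝔼-Σ : ∀ {n} {X : Set} (ρ : BoolFun n → ℚ) (d : X → BoolFun n → ℚ) xs →
    𝔼 ρ (λ f → Σ[ xs ] λ x → d x f) ≡ Σ[ xs ] (λ x → 𝔼 ρ (d x))
  𝔼-Σ {n} ρ d xs = trans (Σ-cong (λ f → sym (Σ-*ˡ (ρ f) (λ x → d x f) xs)) (functions n)) (Σ-swap _ (functions n) xs)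

  -- A probability distribution on the n-adic Boolean functions.
  record IsDistribution {n} (ρ : BoolFun n → ℚ) : Set where
    field
      nonneg : ∀ f → 0ℚ ≤ ρ f
      total  : 𝔼 ρ (const 1ℚ) ≡ 1ℚ

    𝔼-const : ∀ c → 𝔼 ρ (const c) ≡ c
    𝔼-const c = begin
      𝔼 ρ (const c)                ≡⟨ Σ-cong (λ f → cong (ρ f *_) (sym (ℚ.*-identityˡ c))) (functions n) ⟩
      𝔼 ρ (λ _ → 1ℚ * c)           ≡⟨ 𝔼-*ʳ ρ (const 1ℚ) c ⟩
      𝔼 ρ (const 1ℚ) * c           ≡⟨ cong (_* c) total ⟩
      1ℚ * c                       ≡⟨ ℚ.*-identityˡ c ⟩
      c                            ∎
      where open ≡-Reasoning

    𝔼-mono : ∀ {g h} → (∀ f → g f ≤ h f) → 𝔼 ρ g ≤ 𝔼 ρ h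
    𝔼-mono g≤h = Σ-mono (λ f → *-monoʳ-≤ (ρ f) (nonneg f) (g≤h f)) (functions n)

    -- The probability that a random function has the property φ.
    ℙ : (BoolFun n → Bool) → ℚ
    ℙ φ = 𝔼 ρ (λ f → ⟦ φ f ⟧)

    ℙ-cong : ∀ {φ ψ} → φ ≗ ψ → ℙ φ ≡ ℙ ψ
    ℙ-cong φ≗ψ = Σ-cong (λ f → cong (λ b → ρ f * ⟦ b ⟧) (φ≗ψ f)) (functions n)

    ℙ-unit : ∀ φ → InUnit (ℙ φ)
    ℙ-unit φ = Σ-nonneg (λ f → 0≤* (nonneg f) (proj₁ (⟦⟧-unit (φ f)))) (functions n) ,
      subst (ℙ φ ≤_) total (𝔼-mono (λ f → proj₂ (⟦⟧-unit (φ f))))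

    ℙ-not : ∀ φ → ℙ (not ∘ φ) ≡ 1ℚ - ℙ φ
    ℙ-not φ = begin
      ℙ (not ∘ φ)                                ≡⟨ solve 2 (λ a b → a := a :+ b :- b) refl (ℙ (not ∘ φ)) (ℙ φ) ⟩
      ℙ (not ∘ φ) + ℙ φ - ℙ φ                    ≡⟨ cong (_- ℙ φ) (𝔼-+ ρ (⟦_⟧ ∘ not ∘ φ) (⟦_⟧ ∘ φ)) ⟨
      𝔼 ρ (λ f → ⟦ not (φ f) ⟧ + ⟦ φ f ⟧) - ℙ φ  ≡⟨ cong (_- ℙ φ) (trans (Σ-cong (λ f → cong (ρ f *_) (one (φ f))) (functions n)) total) ⟩
      1ℚ - ℙ φ                                   ∎
      where
      open ≡-Reasoning
      one : ∀ b → ⟦ not b ⟧ + ⟦ b ⟧ ≡ 1ℚ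
      one true  = refl
      one false = refl

    -- For independent arguments each of which satisfies φ with probability ℙ φ, the value
    -- of a connective at the truth values of φ has the probability given by the polynomial.
    𝔼-tuples : ∀ φ {k} (α : BoolFun k) →
      Σ[ tuples (functions n) k ] (λ gs → productℚ (Vec.map ρ gs) * ⟦ α (Vec.map φ gs) ⟧) ≡ prob α (ℙ φ)
    𝔼-tuples φ {zero}  α = trans (ℚ.+-identityʳ _) (ℚ.*-identityˡ _)
    𝔼-tuples φ {suc k} α = begin
      Σ[ tuples fs (suc k) ] (λ gs → productℚ (Vec.map ρ gs) * ⟦ α (Vec.map φ gs) ⟧)
        ≡⟨ Σ-product _∷_ fs (tuples fs k) _ ⟩
      Σ[ fs ] (λ g → Σ[ tuples fs k ] λ gs → ρ g * productℚ (Vec.map ρ gs) * ⟦ α (φ g ∷ Vec.map φ gs) ⟧)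
        ≡⟨ Σ-cong inner fs ⟩
      𝔼 ρ (λ g → ⟦ φ g ⟧ * (a - b) + b)
        ≡⟨ 𝔼-+ ρ (λ g → ⟦ φ g ⟧ * (a - b)) (const b) ⟩
      𝔼 ρ (λ g → ⟦ φ g ⟧ * (a - b)) + 𝔼 ρ (const b)
        ≡⟨ cong₂ _+_ (𝔼-*ʳ ρ (⟦_⟧ ∘ φ) (a - b)) (𝔼-const b) ⟩
      ℙ φ * (a - b) + b
        ≡⟨ solve 3 (λ p a b → p :* (a :- b) :+ b := p :* a :+ (con 1ℚ :- p) :* b) refl (ℙ φ) a b ⟩
      ℙ φ * a + (1ℚ - ℙ φ) * b ∎
      where
      open ≡-Reasoning
      fs = functions n
      a = prob (α ∘ (true ∷_)) (ℙ φ)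
      b = prob (α ∘ (false ∷_)) (ℙ φ)
      split : ∀ c → prob (α ∘ (c ∷_)) (ℙ φ) ≡ ⟦ c ⟧ * (a - b) + b
      split true  = solve 2 (λ a b → a := con 1ℚ :* (a :- b) :+ b) refl a b
      split false = solve 2 (λ a b → b := con 0ℚ :* (a :- b) :+ b) refl a b
      inner : ∀ g → Σ[ tuples fs k ] (λ gs → ρ g * productℚ (Vec.map ρ gs) * ⟦ α (φ g ∷ Vec.map φ gs) ⟧) ≡
        ρ g * (⟦ φ g ⟧ * (a - b) + b)
      inner g = trans (Σ-cong (λ gs → ℚ.*-assoc (ρ g) _ _) (tuples fs k))
        (trans (Σ-*ˡ (ρ g) _ (tuples fs k)) (cong (ρ g *_) (trans (𝔼-tuples φ (α ∘ (φ g ∷_))) (split (φ g)))))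

  open IsDistribution

  productℚ-nonneg : ∀ {n k} {ρ : BoolFun n → ℚ} → (∀ f → 0ℚ ≤ ρ f) → ∀ (gs : Vec (BoolFun n) k) → 0ℚ ≤ productℚ (Vec.map ρ gs)
  productℚ-nonneg h []       = 0≤1
  productℚ-nonneg h (g ∷ gs) = 0≤* (h g) (productℚ-nonneg h gs)

  pushforward-nonneg : ∀ {n} {Z : Set} (F : Z → BoolFun n) {w} zs → (∀ z → 0ℚ ≤ w z) → ∀ f → 0ℚ ≤ pushforward F w zs f
  pushforward-nonneg F {w} zs h f = Σ-nonneg (λ z → subst (0ℚ ≤_) (sym (if-⟦⟧ (does (F z ≗? f)) (w z)))
    (0≤* (proj₁ (⟦⟧-unit (does (F z ≗? f)))) (h z))) zs

  -- Two Boolean functions agree everywhere, or the number of points at which they differ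
  -- is at least one.
  agree-or-differ : ∀ {n} (g t : BoolFun n) → g ≗ t ⊎ 1ℚ ≤ Σ[ assignments n ] (λ x → ⟦ g x xor t x ⟧)
  agree-or-differ {zero} g t with g [] in eg | t [] in et
  ... | true  | true  = inj₁ λ { [] → trans eg (sym et) }
  ... | false | false = inj₁ λ { [] → trans eg (sym et) }
  ... | true  | false = inj₂ ℚ.≤-refl
  ... | false | true  = inj₂ ℚ.≤-refl
  agree-or-differ {suc n} g t = subst (λ y → g ≗ t ⊎ 1ℚ ≤ y) (sym (Σ-assignments n (λ x → ⟦ g x xor t x ⟧)))
    (join (agree-or-differ (g ∘ (true ∷_)) (t ∘ (true ∷_))) (agree-or-differ (g ∘ (false ∷_)) (t ∘ (false ∷_))))
    where
    d : Bool → ℚ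
    d b = Σ[ assignments n ] (λ x → ⟦ g (b ∷ x) xor t (b ∷ x) ⟧)
    0≤d : ∀ b → 0ℚ ≤ d b
    0≤d b = Σ-nonneg (λ x → proj₁ (⟦⟧-unit (g (b ∷ x) xor t (b ∷ x)))) (assignments n)
    join : (g ∘ (true ∷_) ≗ t ∘ (true ∷_)) ⊎ 1ℚ ≤ d true → (g ∘ (false ∷_) ≗ t ∘ (false ∷_)) ⊎ 1ℚ ≤ d false →
      g ≗ t ⊎ 1ℚ ≤ d true + d false
    join (inj₁ p) (inj₁ q) = inj₁ λ { (true ∷ x) → p x ; (false ∷ x) → q x }
    join (inj₂ h) _        = inj₂ (ℚ.≤-trans h (≤-by (d false) (0≤d false) refl))
    join _        (inj₂ h) = inj₂ (ℚ.≤-trans h (≤-by (d true) (0≤d true) (ℚ.+-comm (d true) (d false))))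

  module _ {n k} .{{_ : NonZero n}} (α : BoolFun k) where

    private
      μ = uniformProjections n

    𝔼-μ : ∀ {h} → Extensional h → 𝔼 μ h ≡ Σ[ allFin n ] (λ j → (ℤ.+ 1 / n) * h (projection j))
    𝔼-μ = 𝔼-pushforward projection (λ _ → ℤ.+ 1 / n) (allFin n)

    total-μ : Σ[ allFin n ] (λ j → (ℤ.+ 1 / n) * 1ℚ) ≡ 1ℚ
    total-μ = begin
      Σ[ allFin n ] (λ j → (ℤ.+ 1 / n) * 1ℚ)     ≡⟨ Σ-const ((ℤ.+ 1 / n) * 1ℚ) (allFin n) ⟩
      ι (length (allFin n)) * ((ℤ.+ 1 / n) * 1ℚ) ≡⟨ cong₂ (λ l x → ι l * x) (List.length-tabulate {n = n} id) (ℚ.*-identityʳ (ℤ.+ 1 / n)) ⟩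
      ι n * (ℤ.+ 1 / n)                          ≡⟨ ℚ.*-comm (ι n) (ℤ.+ 1 / n) ⟩
      (ℤ.+ 1 / n) * ι n                          ≡⟨ 1/*ι n ⟩
      1ℚ                                       ∎
      where open ≡-Reasoning

    growth-distribution : ∀ i → IsDistribution (growth μ α i)
    growth-distribution zero = record
      { nonneg = pushforward-nonneg projection (allFin n) (λ _ → ℚ.<⇒≤ (0<1/ n))
      ; total  = trans (𝔼-μ (λ _ → refl)) total-μ
      }
    growth-distribution (suc i) = record
      { nonneg = pushforward-nonneg (compose α) (tuples (functions n) k) (productℚ-nonneg (nonneg D))
      ; total  = trans (𝔼-pushforward (compose α) _ (tuples (functions n) k) (λ _ → refl))
                   (trans (𝔼-tuples D (const true) {k} (const true)) (prob-true {k} (ℙ D (const true))))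
      }
      where D = growth-distribution i

    -- The probability that the function grown in i steps is true at x.
    truth : ℕ → Vec Bool n → ℚ
    truth i x = ℙ (growth-distribution i) (λ f → f x)

    truth-suc : ∀ i x → truth (suc i) x ≡ prob α (truth i x)
    truth-suc i x = trans (𝔼-pushforward (compose α) _ (tuples (functions n) k) (λ e → cong ⟦_⟧ (e x)))
      (𝔼-tuples (growth-distribution i) (λ f → f x) α)

    growth-as-ℙ : ∀ i f → growth μ α i f ≡ ℙ (growth-distribution i) (λ g → does (g ≗? f))
    growth-as-ℙ zero    f = pushforward-as-𝔼 projection _ (allFin n) f
    growth-as-ℙ (suc i) f = pushforward-as-𝔼 (compose α) _ (tuples (functions n) k) f

    truth-zero-true : ∀ x → (∀ j → lookup x j ≡ true) → truth 0 x ≡ 1ℚ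
    truth-zero-true x h = trans (𝔼-μ (λ e → cong ⟦_⟧ (e x)))
      (trans (Σ-cong (λ j → cong (λ b → (ℤ.+ 1 / n) * ⟦ b ⟧) (h j)) (allFin n)) total-μ)

    -- A projection to a uniformly chosen variable hits the false entry j with probability 1/n.
    truth-zero-false : ∀ x j → lookup x j ≡ false → truth 0 x ≤ 1ℚ - ℤ.+ 1 / n
    truth-zero-false x j h = ≤-by (t′ - ℤ.+ 1 / n) (0≤- one) (begin
      1ℚ - ℤ.+ 1 / n                          ≡⟨ cong (_- ℤ.+ 1 / n) (sym both) ⟩
      (truth 0 x + t′) - ℤ.+ 1 / n            ≡⟨ solve 3 (λ a b c → (a :+ b) :- c := a :+ (b :- c)) refl (truth 0 x) t′ (ℤ.+ 1 / n) ⟩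
      truth 0 x + (t′ - ℤ.+ 1 / n)            ∎)
      where
      open ≡-Reasoning
      g : Fin n → ℚ
      g i = (ℤ.+ 1 / n) * ⟦ not (lookup x i) ⟧
      t′ = Σ[ allFin n ] g
      one : ℤ.+ 1 / n ≤ t′
      one = subst (_≤ t′) (trans (cong (λ b → (ℤ.+ 1 / n) * ⟦ not b ⟧) h) (ℚ.*-identityʳ (ℤ.+ 1 / n)))
        (Σ-∈ (λ i → 0≤* (ℚ.<⇒≤ (0<1/ n)) (proj₁ (⟦⟧-unit (not (lookup x i))))) (∈-allFin j))
      both : truth 0 x + t′ ≡ 1ℚ
      both = trans (cong (_+ t′) (𝔼-μ (λ e → cong ⟦_⟧ (e x)))) (trans (sym (Σ-+ _ g (allFin n)))
        (trans (Σ-cong (λ i → trans (cong ((ℤ.+ 1 / n) * ⟦ lookup x i ⟧ +_) (cong ((ℤ.+ 1 / n) *_) (⟦not⟧ (lookup x i))))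
          (solve 2 (λ c a → c :* a :+ c :* (con 1ℚ :- a) := c :* con 1ℚ) refl (ℤ.+ 1 / n) ⟦ lookup x i ⟧)) (allFin n)) total-μ))

    -- The distance between the grown distribution and the point mass at t is at most the
    -- probability that a random function differs from t, to which a union bound over
    -- the points applies.
    growth-union-bound : ∀ t i f →
      ∣ growth μ α i f - ⟦ does (t ≗? f) ⟧ ∣ ≤ Σ[ assignments n ] (λ x → ℙ (growth-distribution i) (λ g → g x xor t x))
    growth-union-bound t i f = ∣∣≤ (begin
        growth μ α i f - T                   ≤⟨ ℚ.+-monoˡ-≤ (- T) upper ⟩
        (T + E) - T                          ≡⟨ solve 2 (λ t e → (t :+ e) :- t := e) refl T E ⟩
        E                                    ≡⟨ E≡ ⟩
        _                                    ∎)
      (begin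
        - (growth μ α i f - T)               ≡⟨ solve 2 (λ g t → :- (g :- t) := t :- g) refl (growth μ α i f) T ⟩
        T - growth μ α i f                   ≤⟨ ℚ.+-monoˡ-≤ (- growth μ α i f) lower ⟩
        (growth μ α i f + E) - growth μ α i f  ≡⟨ solve 2 (λ t e → (t :+ e) :- t := e) refl (growth μ α i f) E ⟩
        E                                    ≡⟨ E≡ ⟩
        _                                    ∎)
      where
      open ℚ.≤-Reasoning
      D = growth-distribution i
      T = ⟦ does (t ≗? f) ⟧
      d : BoolFun n → ℚ
      d g = Σ[ assignments n ] λ x → ⟦ g x xor t x ⟧
      E = 𝔼 (growth μ α i) d
      E≡ : E ≡ Σ[ assignments n ] (λ x → ℙ D (λ g → g x xor t x))
      E≡ = 𝔼-Σ (growth μ α i) (λ x g → ⟦ g x xor t x ⟧) (assignments n)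
      d-nonneg : ∀ g → 0ℚ ≤ d g
      d-nonneg g = Σ-nonneg (λ x → proj₁ (⟦⟧-unit (g x xor t x))) (assignments n)
      -- If g and t agree, the two indicators are equal; otherwise d g is at least one.
      pointwise : ∀ g → ⟦ does (g ≗? f) ⟧ ≤ T + d g × T ≤ ⟦ does (g ≗? f) ⟧ + d g
      pointwise g with agree-or-differ g t
      ... | inj₁ g≗t rewrite does-≗?-ext f g≗t = ≤-by (d g) (d-nonneg g) refl , ≤-by (d g) (d-nonneg g) refl
      ... | inj₂ 1≤d = far (does (g ≗? f)) (does (t ≗? f)) , far (does (t ≗? f)) (does (g ≗? f))
        where
        far : ∀ a b → ⟦ a ⟧ ≤ ⟦ b ⟧ + d g
        far a b = ℚ.≤-trans (proj₂ (⟦⟧-unit a)) (ℚ.≤-trans 1≤d (≤-by ⟦ b ⟧ (proj₁ (⟦⟧-unit b)) (ℚ.+-comm ⟦ b ⟧ (d g))))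
      upper : growth μ α i f ≤ T + E
      upper = begin
        growth μ α i f                           ≡⟨ growth-as-ℙ i f ⟩
        ℙ D (λ g → does (g ≗? f))                ≤⟨ 𝔼-mono D (λ g → proj₁ (pointwise g)) ⟩
        𝔼 (growth μ α i) (λ g → T + d g)         ≡⟨ 𝔼-+ (growth μ α i) (const T) d ⟩
        𝔼 (growth μ α i) (const T) + E           ≡⟨ cong (_+ E) (𝔼-const D T) ⟩
        T + E                                    ∎
      lower : T ≤ growth μ α i f + E
      lower = begin
        T                                        ≡⟨ 𝔼-const D T ⟨
        𝔼 (growth μ α i) (const T)               ≤⟨ 𝔼-mono D (λ g → proj₂ (pointwise g)) ⟩
        𝔼 (growth μ α i) (λ g → ⟦ does (g ≗? f) ⟧ + d g)  ≡⟨ 𝔼-+ (growth μ α i) (λ g → ⟦ does (g ≗? f) ⟧) d ⟩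
        ℙ D (λ g → does (g ≗? f)) + E            ≡⟨ cong (_+ E) (growth-as-ℙ i f) ⟨
        growth μ α i f + E                       ∎

-- Convergence to the limit function
module Limit where

  open import Data.Rational.Base using (_+_; _*_; _-_; -_; _≤_; _<_; ∣_∣)
  open Defs hiding (_+_; _*_; _-_; -_; _<_; _≤_; ∣_∣)
  open Rationals
  open Sums
  open Polynomial
  open Iteration
  open Growth

  -- The conjunction of all variables.
  conjunction : ∀ {n} → BoolFun n
  conjunction []      = true
  conjunction (b ∷ x) = b ∧ conjunction x

  conjunction-true : ∀ {n} (x : Vec Bool n) → conjunction x ≡ true → ∀ j → lookup x j ≡ true
  conjunction-true (true ∷ x) h zero    = refl
  conjunction-true (true ∷ x) h (suc j) = conjunction-true x h j

  conjunction-false : ∀ {n} (x : Vec Bool n) → conjunction x ≡ false → ∃ λ j → lookup x j ≡ false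
  conjunction-false (false ∷ x) h = zero , refl
  conjunction-false (true ∷ x)  h = let j , e = conjunction-false x h in suc j , e

  -- The function at which the limiting distribution is concentrated: the conjunction if α
  -- is true at the all-true assignment, and constantly false if it is not, provided that
  -- α is false at the all-false assignment.
  limit-function : ∀ {k} → BoolFun k → ∀ {n} → BoolFun n
  limit-function {k} α x = α (Vec.replicate k (conjunction x))

  Σ-assignments-const : ∀ n M → Σ[ assignments n ] (λ _ → ½ ^ℚ (n ℕ.+ M)) ≡ ½ ^ℚ M
  Σ-assignments-const zero    M = ℚ.+-identityʳ (½ ^ℚ M)
  Σ-assignments-const (suc n) M = begin
    Σ[ assignments (suc n) ] (λ _ → c)                       ≡⟨ Σ-assignments n (const c) ⟩
    Σ[ assignments n ] (λ _ → c) + Σ[ assignments n ] (λ _ → c)  ≡⟨ Σ-+ (const c) (const c) (assignments n) ⟨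
    Σ[ assignments n ] (λ _ → c + c)                         ≡⟨ Σ-cong (λ _ → ½^-suc-+ (n ℕ.+ M)) (assignments n) ⟩
    Σ[ assignments n ] (λ _ → ½ ^ℚ (n ℕ.+ M))                ≡⟨ Σ-assignments-const n M ⟩
    ½ ^ℚ M                                                   ∎
    where
    open ≡-Reasoning
    c = ½ ^ℚ (suc n ℕ.+ M)

  module _ {k} (α : BoolFun k) (mono : Monotone α) (zeros : α (Vec.replicate k false) ≡ false)
    {n} .{{_ : NonZero n}} where

    private
      μ = uniformProjections n
      t : BoolFun n
      t = limit-function α
      -- The probability that the function grown in i steps differs from t at x.
      error : ℕ → Vec Bool n → ℚ
      error i x = IsDistribution.ℙ (growth-distribution α i) (λ g → g x xor t x)

    error-cong : ∀ i x {b} → t x ≡ b → error i x ≡ IsDistribution.ℙ (growth-distribution α i) (λ g → g x xor b)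
    error-cong i x e = IsDistribution.ℙ-cong (growth-distribution α i) (λ g → cong (g x xor_) e)

    truth≤orbit : ∀ x → conjunction x ≡ false → ∀ i → truth α i x ≤ orbit (prob α) (1ℚ - ℤ.+ 1 / n) i
    truth≤orbit x h zero    = let j , e = conjunction-false x h in truth-zero-false α x j e
    truth≤orbit x h (suc i) = subst (_≤ prob α (orbit (prob α) (1ℚ - ℤ.+ 1 / n) i)) (sym (truth-suc α i x))
      (prob-mono mono (IsDistribution.ℙ-unit (growth-distribution α i) (λ g → g x))
        (orbit-InUnit (prob-unit α) (∁-InUnit (ℚ.<⇒≤ (0<1/ n) , 1/≤1 n)) i) (truth≤orbit x h i))

    -- At the all-true assignment every variable is true, so the first step already yields the
    -- value of α there; later steps reproduce it.
    truth-ones : ∀ x → conjunction x ≡ true → ∀ i → truth α (suc i) x ≡ ⟦ α (Vec.replicate k true) ⟧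
    truth-ones x h zero    = trans (truth-suc α 0 x)
      (trans (cong (prob α) (truth-zero-true α x (conjunction-true x h))) (prob-0-1 α true))
    truth-ones x h (suc i) = trans (truth-suc α (suc i) x)
      (trans (cong (prob α) (truth-ones x h i)) (trans (prob-0-1 α b) (cong ⟦_⟧ (stable b refl))))
      where
      b = α (Vec.replicate k true)
      stable : ∀ c → b ≡ c → α (Vec.replicate k c) ≡ c
      stable true  e = e
      stable false e = zeros

    error-ones : ∀ x → conjunction x ≡ true → ∀ i → error (suc i) x ≡ 0ℚ
    error-ones x h i = trans (error-cong (suc i) x (cong (α ∘ Vec.replicate k) h))
      (at (α (Vec.replicate k true)) (truth-ones x h i))
      where
      open IsDistribution (growth-distribution α (suc i))
      at : ∀ b → truth α (suc i) x ≡ ⟦ b ⟧ → ℙ (λ g → g x xor b) ≡ 0ℚ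
      at true  e = trans (ℙ-cong (λ g → Bool.xor-comm (g x) true))
        (trans (ℙ-not (λ g → g x)) (trans (cong (λ y → 1ℚ - y) e) (ℚ.+-inverseʳ 1ℚ)))
      at false e = trans (ℙ-cong (λ g → Bool.xor-identityʳ (g x))) e

    error≤orbit : ∀ i x → error (suc i) x ≤ orbit (prob α) (1ℚ - ℤ.+ 1 / n) (suc i)
    error≤orbit i x = at (conjunction x) refl
      where
      at : ∀ b → conjunction x ≡ b → error (suc i) x ≤ orbit (prob α) (1ℚ - ℤ.+ 1 / n) (suc i)
      at true  h = subst (_≤ orbit (prob α) (1ℚ - ℤ.+ 1 / n) (suc i)) (sym (error-ones x h i))
        (proj₁ (orbit-InUnit (prob-unit α) (∁-InUnit (ℚ.<⇒≤ (0<1/ n) , 1/≤1 n)) (suc i)))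
      at false h = subst (_≤ orbit (prob α) (1ℚ - ℤ.+ 1 / n) (suc i))
        (sym (trans (error-cong (suc i) x (trans (cong (α ∘ Vec.replicate k) h) zeros))
          (IsDistribution.ℙ-cong (growth-distribution α (suc i)) (λ g → Bool.xor-identityʳ (g x)))))
        (truth≤orbit x h (suc i))

    growth≈limit : ∀ i M → orbit (prob α) (1ℚ - ℤ.+ 1 / n) (suc i) ≤ ½ ^ℚ (n ℕ.+ M) →
      ∀ f → ∣ growth μ α (suc i) f - ⟦ does (t ≗? f) ⟧ ∣ ≤ ½ ^ℚ M
    growth≈limit i M h f = begin
      ∣ growth μ α (suc i) f - ⟦ does (t ≗? f) ⟧ ∣   ≤⟨ growth-union-bound α t (suc i) f ⟩
      Σ[ assignments n ] (error (suc i))             ≤⟨ Σ-mono (λ x → ℚ.≤-trans (error≤orbit i x) h) (assignments n) ⟩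
      Σ[ assignments n ] (λ _ → ½ ^ℚ (n ℕ.+ M))      ≡⟨ Σ-assignments-const n M ⟩
      ½ ^ℚ M                                         ∎
      where open ℚ.≤-Reasoning

  -- The number L is the integral part of the binary logarithm of n.
  binary-length : ∀ n .{{_ : NonZero n}} → ∃ λ L → 2 ^ L ℕ.≤ n × n ℕ.< 2 ^ suc L
  binary-length (suc zero) = 0 , s≤s z≤n , s≤s (s≤s z≤n)
  binary-length (suc n@(suc _)) with binary-length n
  ... | L , lo , hi with suc n ℕ.<? 2 ^ suc L
  ...   | yes h = L , ℕ.≤-trans lo (ℕ.n≤1+n n) , h
  ...   | no  h = suc L , ℕ.≮⇒≥ h , ℕ.≤-<-trans hi (ℕ.^-monoʳ-< 2 (s≤s (s≤s z≤n)) (ℕ.n<1+n (suc L)))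

  -- Each term of the sequence that represents log₂ n is bounded below by the integral part.
  ι≤log₂ : ∀ n .{{_ : NonZero n}} L → 2 ^ L ℕ.≤ n → ∀ m → ι L ≤ seq (log₂ n) m
  ι≤log₂ n L h m = ℚ.*-cancelʳ-≤-pos (ι (suc m)) {{ℚ.positive (0<ι (suc m))}} (begin
    ι L * ι (suc m)                    ≡⟨ ι-* L (suc m) ⟨
    ι (L ℕ.* suc m)                    ≤⟨ ι-mono (subst (ℕ._≤ ⌊log₂ n ^ suc m ⌋) (⌊log₂[2^n]⌋≡n (L ℕ.* suc m))
                                            (⌊log₂⌋-mono-≤ (subst (ℕ._≤ n ^ suc m) (ℕ.^-*-assoc 2 L (suc m)) (ℕ.^-monoˡ-≤ (suc m) h)))) ⟩
    ι ⌊log₂ n ^ suc m ⌋                ≡⟨ /-*-ι ⌊log₂ n ^ suc m ⌋ (suc m) ⟨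
    seq (log₂ n) m * ι (suc m)         ∎)
    where open ℚ.≤-Reasoning

  enough-steps : ∀ n .{{_ : NonZero n}} L c i → 2 ^ L ℕ.≤ n →
    fromℕ 3 Defs.* log₂ n Defs.+ fromℕ c Defs.≤ fromℕ i → 3 ℕ.* L ℕ.+ c ℕ.≤ i
  enough-steps n L c i 2^L≤n h = ℕ.≮⇒≥ λ i< → h (1ℚ , 0<1 , 0 , λ m _ → begin
    ℤ.+ i / 1 + 1ℚ                            ≡⟨ cong (_+ 1ℚ) (ι-def i) ⟨
    ι i + 1ℚ                                  ≡⟨ ℚ.+-comm (ι i) 1ℚ ⟩
    1ℚ + ι i                                  ≡⟨ ι-suc i ⟨
    ι (suc i)                                 ≤⟨ ι-mono i< ⟩
    ι (3 ℕ.* L ℕ.+ c)                         ≡⟨ trans (ι-+ (3 ℕ.* L) c) (cong (_+ ι c) (ι-* 3 L)) ⟩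
    ι 3 * ι L + ι c                           ≤⟨ ℚ.+-monoˡ-≤ (ι c) (*-monoʳ-≤ (ι 3) (0≤ι 3) (ι≤log₂ n L 2^L≤n m)) ⟩
    ι 3 * seq (log₂ n) m + ι c                ≡⟨ cong₂ (λ x y → x * seq (log₂ n) m + y) (ι-def 3) (ι-def c) ⟩
    (ℤ.+ 3 / 1) * seq (log₂ n) m + ℤ.+ c / 1    ∎)
    where open ℚ.≤-Reasoning

  1/2^ : ∀ n → ratio 1 (2 ^ n) ≡ ½ ^ℚ n
  1/2^ n = ℚ.≤-antisym (cancel (ℚ.≤-reflexive e)) (cancel (ℚ.≤-reflexive (sym e)))
    where
    instance
      nz : NonZero (2 ^ n)
      nz = ℕ.m^n≢0 2 n
    e : ratio 1 (2 ^ n) * ι (2 ^ n) ≡ ½ ^ℚ n * ι (2 ^ n)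
    e = trans (ratio-*-ι 1 (2 ^ n)) (trans ι1≡1 (sym (½^*ι2^ n)))
    cancel : ∀ {a b} → a * ι (2 ^ n) ≤ b * ι (2 ^ n) → a ≤ b
    cancel = ℚ.*-cancelʳ-≤-pos (ι (2 ^ n)) {{ℚ.positive (0<ι (2 ^ n))}}

  module Convergence {k} (α : BoolFun k) (mono : Monotone α) (zeros : α (Vec.replicate k false) ≡ false) where

    -- The decay of the orbit of 1 - 1/n.  The number of steps is written 3l + c + 1 so that it is
    -- positive: the function grown in 0 steps need not have its limiting value at the
    -- all-true assignment.
    Decay : ℕ → Set
    Decay c = ∀ (n : ℕ) .{{_ : NonZero n}} l → n ℕ.≤ 2 ^ l → ∀ i → 3 ℕ.* l ℕ.+ suc c ℕ.≤ i →
      orbit (prob α) (1ℚ - ℤ.+ 1 / n) i ≤ ½ ^ℚ (2 ^ l ℕ.* 4)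

    -- The point mass at the limit function.
    limit : ∀ n → BoolFun n → ℚ
    limit n f = ⟦ does (limit-function α ≗? f) ⟧

    module _ (c : ℕ) (decay : Decay c) where

      growth-close : ∀ n .{{_ : NonZero n}} l M i → n ℕ.≤ 2 ^ l → n ℕ.+ M ℕ.≤ 2 ^ l ℕ.* 4 → 3 ℕ.* l ℕ.+ suc c ℕ.≤ i →
        ∀ f → ∣ growth (uniformProjections n) α i f - limit n f ∣ ≤ ½ ^ℚ M
      growth-close n l M zero    n≤ M≤ i≥ = contradiction (ℕ.≤-trans (ℕ.m≤n+m (suc c) (3 ℕ.* l)) i≥) λ ()
      growth-close n l M (suc i) n≤ M≤ i≥ = growth≈limit α mono zeros i M
        (ℚ.≤-trans (decay n l n≤ (suc i) i≥) (½^-antitone M≤))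

      -- Choosing l large compared with n makes the bound of growth-close arbitrarily small.
      limiting : ∀ n .{{_ : NonZero n}} → IsLimitingDistribution (uniformProjections n) α (fromℚ ∘ limit n)
      limiting n f ε (ε₀ , 0<ε₀ , N₀ , ε₀≤ε) =
        let m , ½^m≤ε₀ = ½^-small 0<ε₀
            l = n ℕ.+ suc m
        in 3 ℕ.* l ℕ.+ suc c , λ i i≥ → ½ ^ℚ suc m , 0<½^ (suc m) , N₀ , λ j j≥ → begin
          ∣ growth (uniformProjections n) α i f - limit n f ∣ + ½ ^ℚ suc m
            ≤⟨ ℚ.+-monoˡ-≤ (½ ^ℚ suc m) (growth-close n l (suc m) i (ℕ.≤-trans (ℕ.m≤m+n n (suc m)) (ℕ.<⇒≤ (n<2^n l)))
                 (ℕ.≤-trans (ℕ.<⇒≤ (n<2^n l)) (ℕ.m≤m*n (2 ^ l) 4)) i≥ f) ⟩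
          ½ ^ℚ suc m + ½ ^ℚ suc m      ≡⟨ ½^-suc-+ m ⟩
          ½ ^ℚ m                       ≤⟨ ½^m≤ε₀ ⟩
          ε₀                           ≡⟨ ℚ.+-identityˡ ε₀ ⟨
          0ℚ + ε₀                      ≤⟨ ε₀≤ε j j≥ ⟩
          seq ε j                      ∎
        where open ℚ.≤-Reasoning

      -- With l = L + 1, where L is the integral part of the logarithm, n ≤ 2^l holds and the
      -- additional 3 is absorbed by the constant.  Aiming at half of 2^(-n) makes the
      -- inequality strict.
      convergence-rate : ∀ n .{{_ : NonZero n}} i → fromℕ 3 Defs.* log₂ n Defs.+ fromℕ (3 ℕ.+ suc c) Defs.≤ fromℕ i →
        ∀ f → Defs.∣ fromℚ (growth (uniformProjections n) α i f) Defs.- fromℚ (limit n f) ∣ Defs.< fromℚ (ratio 1 (2 ^ n))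
      convergence-rate n i h f =
        let L , lo , hi = binary-length n
            i≥ = subst (ℕ._≤ i) (shift L c) (enough-steps n L (3 ℕ.+ suc c) i lo h)
        in ½ ^ℚ suc n , 0<½^ (suc n) , 0 , λ _ _ → begin
          ∣ growth (uniformProjections n) α i f - limit n f ∣ + ½ ^ℚ suc n
            ≤⟨ ℚ.+-monoˡ-≤ (½ ^ℚ suc n) (growth-close n (suc L) (suc n) i
                 (ℕ.<⇒≤ hi) (room (ℕ.<⇒≤ hi) (ℕ.m^n>0 2 (suc L))) i≥ f) ⟩
          ½ ^ℚ suc n + ½ ^ℚ suc n      ≡⟨ ½^-suc-+ n ⟩
          ½ ^ℚ n                       ≡⟨ 1/2^ n ⟨
          ratio 1 (2 ^ n)              ∎
        where
        open ℚ.≤-Reasoning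
        shift : ∀ L d → 3 ℕ.* L ℕ.+ (3 ℕ.+ suc d) ≡ 3 ℕ.* suc L ℕ.+ suc d
        shift = ℕ-Solver.solve-∀
        room : ∀ {a} → n ℕ.≤ a → 1 ℕ.≤ a → n ℕ.+ suc n ℕ.≤ a ℕ.* 4
        room {a} n≤a 1≤a = ℕ.≤-trans (ℕ.+-mono-≤ n≤a (ℕ.+-mono-≤ 1≤a n≤a))
          (ℕ.≤-trans (ℕ.m≤m+n (a ℕ.+ (a ℕ.+ a)) a) (ℕ.≤-reflexive (four a)))
          where
          four : ∀ a → a ℕ.+ (a ℕ.+ a) ℕ.+ a ≡ a ℕ.* 4
          four = ℕ-Solver.solve-∀

      converges : ∀ n .{{_ : NonZero n}} → ∃ λ (π : BoolFun n → ℝ) →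
        IsLimitingDistribution (uniformProjections n) α π ×
        (∀ i → fromℕ 3 Defs.* log₂ n Defs.+ fromℕ (3 ℕ.+ suc c) Defs.≤ fromℕ i →
          ∀ f → Defs.∣ fromℚ (growth (uniformProjections n) α i f) Defs.- π f ∣ Defs.< fromℚ (ratio 1 (2 ^ n)))
      converges n = fromℚ ∘ limit n , limiting n , convergence-rate n

open import Defs
open import Data.Nat.Base using (ℕ; NonZero; _∸_; _^_) renaming (_>_ to _>ℕ_)
open import Data.Product.Base using (∃; _×_)
open import Data.Rational.Base using () renaming (_≤_ to _≤ℚ_)

theorem5p9 : ∀ {k : ℕ} (α : BoolFun k) → Monotone α →
    (∀ p → 0ℝ < p → p < 1ℝ → A α p < p) →
    k >ℕ 2 →
    β α (k ∸ 1) ≤ℚ ratio (k ∸ 2) k →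
    ∃ λ (c : ℝ) →
    ∀ (n : ℕ) .{{_ : NonZero n}} →
    ∃ λ (π : BoolFun n → ℝ) →
    IsLimitingDistribution (uniformProjections n) α π ×
    (∀ (i : ℕ) → fromℕ 3 * log₂ n + c ≤ fromℕ i →
    ∀ (f : BoolFun n) →
    ∣ fromℚ (growth (uniformProjections n) α i f) - π f ∣ < fromℚ (ratio 1 (2 ^ n)))
theorem5p9 {suc (suc m)} α mono below (s≤s (s≤s _)) few = conclude (Connective.Rates.decay α mono below few)
  where
  open Limit.Convergence α mono (Connective.BelowDiagonal.zeros-false α below mono)
  conclude : (∃ λ c → Decay c) → _
  conclude (c , decay) = fromℕ (3 ℕ.+ suc c) , converges c decay
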